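{- Let $c_0$ be a proper $4$-colouring of the plane, let $\mu$ be a left-invariant finitely additive probability measure on $S_4\times E(2)$, and let $p_d$ be the associated monochromaticity probabilities (see context). If $0\le d\le\frac{\sqrt5-1}{\sqrt3}$, then $p_d\ge\frac1{325}$.
   Context: Identify the plane with $\mathbb C$. A proper $4$-colouring of the plane is a map $c_0:\mathbb C\to\{1,2,3,4\}$ such that no two points at distance $1$ have the same colour. Let $S_4$ be the group of permutations of the colours and $E(2)$ the group of Euclidean isometries of the plane. The group $S_4\times E(2)$ is amenable, so there is a finitely additive probability measure $\mu$ defined on all subsets of $S_4\times E(2)$ which is left-invariant, i.e. $\mu(gE)=\mu(E)$ for all $g\in S_4\times E(2)$ and $E\subseteq S_4\times E(2)$. For $(\sigma,T)\in S_4\times E(2)$ consider the (random) colouring $c=\sigma\circ c_0\circ T^{ -1}$. For $d\ge 0$, $p_d$ denotes the probability that two points $A,B$ at distance $d$ get the same colour: $p_d=\mu(\{(\sigma,T): c(A)=c(B)\})$; by left-invariance this does not depend on the choice of $A,B$ with $|AB|=d$. The existence of $c_0$ is a standing assumption, and $c_0,\mu$ are arbitrary but fixed. -}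

module Defs where

open import Algebra.Bundles using (CommutativeRing; Group)
open import Algebra.Construct.DirectProduct using (group)
open import Data.Fin.Base using (Fin)
open import Data.Nat.Base using (ℕ)
open import Data.Product.Base using (∃; _×_; _,_; proj₁; proj₂)
open import Data.Product.Relation.Binary.Pointwise.NonDependent using (×-setoid)
open import Data.Sum.Base as Sum using (inj₁; inj₂)
open import Data.Unit.Base using (⊤)
open import Function.Bundles using (Func; Inverse)
import Function.Construct.Composition as Composition
import Function.Construct.Identity as Identity
import Function.Construct.Symmetry as Symmetry
open import Level using (0ℓ)
open import Relation.Binary.Bundles using (Setoid)
open import Relation.Binary.Core using (Rel)
open import Relation.Binary.Definitions using (_Respects_)
open import Relation.Binary.PropositionalEquality as ≡ using (_≡_; _≢_)
open import Relation.Binary.Structures using (IsDecTotalOrder)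
open import Relation.Nullary.Decidable.Core using (Dec; yes; no)
open import Relation.Nullary.Negation.Core using (¬_; contradiction)
open import Relation.Unary using (Pred; Satisfiable; _≐_; _⊥_; _∪_)

-- The real numbers, axiomatically: a Dedekind-complete totally ordered field.
-- The ordinary classical reading of ℝ is intended, so equality and order are
-- decidable.
record CompleteOrderedField : Set₁ where
  field
    commutativeRing : CommutativeRing 0ℓ 0ℓ

  open CommutativeRing commutativeRing public
    hiding (isPartialEquivalence; reflexive)

  infix 4 _≤_

  field
    _≤_ : Rel Carrier 0ℓ

  UpperBound : Pred Carrier 0ℓ → Pred Carrier 0ℓ
  UpperBound P b = ∀ x → P x → x ≤ b

  field
    isDecTotalOrder : IsDecTotalOrder _≈_ _≤_
    0≉1             : ¬ 0# ≈ 1#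
    invertible      : ∀ x → ¬ x ≈ 0# → ∃ λ y → x * y ≈ 1#
    +-monoʳ-≤       : ∀ z {x y} → x ≤ y → z + x ≤ z + y
    *-nonNegative   : ∀ {x y} → 0# ≤ x → 0# ≤ y → 0# ≤ x * y
    supremum        : ∀ (P : Pred Carrier 0ℓ) →
                      Satisfiable P → Satisfiable (UpperBound P) →
                      ∃ λ s → UpperBound P s × (∀ b → UpperBound P b → s ≤ b)

module RealArithmetic (ℝ : CompleteOrderedField) where

  open CompleteOrderedField ℝ public
  open IsDecTotalOrder isDecTotalOrder public
    using (antisym; total; _≟_; _≤?_; ≤-respˡ-≈; ≤-respʳ-≈)
    renaming (refl to ≤-refl; trans to ≤-trans; reflexive to ≤-reflexive)

  open import Algebra.Properties.Group +-group using (∙-cancelˡ)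
  open import Algebra.Properties.Ring ring using (-‿distribˡ-*; -‿distribʳ-*; -‿involutive)
  open import Algebra.Properties.Semiring.Mult semiring using () renaming (_×_ to _times_)
  open import Algebra.Solver.Ring.NaturalCoefficients.Default commutativeSemiring
    using (solve; _:=_; _:+_; _:*_)
  open import Relation.Binary.Reasoning.Setoid setoid

  infix  8 √_ _⁻¹
  infixl 7 _/_

  fromℕ : ℕ → Carrier
  fromℕ n = n times 1#

  -- Total, with the convention 0⁻¹ = 0.
  _⁻¹ : Carrier → Carrier
  x ⁻¹ with x ≟ 0#
  ... | yes _   = 0#
  ... | no  x≉0 = proj₁ (invertible x x≉0)

  _/_ : Carrier → Carrier → Carrier
  x / y = x * y ⁻¹

  ⁻¹-inverseʳ : ∀ x → ¬ x ≈ 0# → x * x ⁻¹ ≈ 1#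
  ⁻¹-inverseʳ x x≉0 with x ≟ 0#
  ... | yes x≈0 = contradiction x≈0 x≉0
  ... | no  x≉0 = proj₂ (invertible x x≉0)

  +-mono-≤ : ∀ {w x y z} → w ≤ x → y ≤ z → w + y ≤ x + z
  +-mono-≤ {w} {x} {y} {z} w≤x y≤z = ≤-trans (+-monoʳ-≤ w y≤z)
    (≤-respˡ-≈ (+-comm z w) (≤-respʳ-≈ (+-comm z x) (+-monoʳ-≤ z w≤x)))

  +-nonNegative : ∀ {x y} → 0# ≤ x → 0# ≤ y → 0# ≤ x + y
  +-nonNegative 0≤x 0≤y = ≤-respˡ-≈ (+-identityˡ 0#) (+-mono-≤ 0≤x 0≤y)

  neg-nonNegative : ∀ {x} → x ≤ 0# → 0# ≤ - x
  neg-nonNegative {x} x≤0 =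
    ≤-respˡ-≈ (-‿inverseˡ x) (≤-respʳ-≈ (+-identityʳ (- x)) (+-monoʳ-≤ (- x) x≤0))

  x≤y⇒0≤y-x : ∀ {x y} → x ≤ y → 0# ≤ y - x
  x≤y⇒0≤y-x {x} {y} x≤y =
    ≤-respˡ-≈ (-‿inverseˡ x) (≤-respʳ-≈ (+-comm (- x) y) (+-monoʳ-≤ (- x) x≤y))

  x+[y-x]≈y : ∀ x y → x + (y - x) ≈ y
  x+[y-x]≈y x y = begin
    x + (y - x)   ≈⟨ +-congˡ (+-comm y (- x)) ⟩
    x + (- x + y) ≈⟨ +-assoc x (- x) y ⟨
    x - x + y     ≈⟨ +-congʳ (-‿inverseʳ x) ⟩
    0# + y        ≈⟨ +-identityˡ y ⟩
    y             ∎

  x≤x+y : ∀ x {y} → 0# ≤ y → x ≤ x + y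
  x≤x+y x 0≤y = ≤-respˡ-≈ (+-identityʳ x) (+-monoʳ-≤ x 0≤y)

  x+y≤x⇒y≤0 : ∀ x {y} → x + y ≤ x → y ≤ 0#
  x+y≤x⇒y≤0 x {y} le = ≤-respˡ-≈ eq (≤-respʳ-≈ (-‿inverseˡ x) (+-monoʳ-≤ (- x) le))
    where
    eq : - x + (x + y) ≈ y
    eq = begin
      - x + (x + y) ≈⟨ +-assoc (- x) x y ⟨
      - x + x + y   ≈⟨ +-congʳ (-‿inverseˡ x) ⟩
      0# + y        ≈⟨ +-identityˡ y ⟩
      y             ∎

  *-monoˡ-≤ : ∀ {z} → 0# ≤ z → ∀ {x y} → x ≤ y → z * x ≤ z * y
  *-monoˡ-≤ {z} 0≤z {x} {y} x≤y = ≤-respʳ-≈ eq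
    (x≤x+y (z * x) (*-nonNegative 0≤z (x≤y⇒0≤y-x x≤y)))
    where
    eq : z * x + z * (y - x) ≈ z * y
    eq = trans (sym (distribˡ z x (y - x))) (*-congˡ (x+[y-x]≈y x y))

  0≤x² : ∀ x → 0# ≤ x * x
  0≤x² x with total 0# x
  ... | inj₁ 0≤x = *-nonNegative 0≤x 0≤x
  ... | inj₂ x≤0 = ≤-respʳ-≈ eq (*-nonNegative (neg-nonNegative x≤0) (neg-nonNegative x≤0))
    where
    eq : - x * - x ≈ x * x
    eq = begin
      - x * - x   ≈⟨ -‿distribˡ-* x (- x) ⟨
      - (x * - x) ≈⟨ -‿cong (sym (-‿distribʳ-* x x)) ⟩
      - - (x * x) ≈⟨ -‿involutive (x * x) ⟩
      x * x       ∎

  0≤1 : 0# ≤ 1#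
  0≤1 = ≤-respʳ-≈ (*-identityˡ 1#) (0≤x² 1#)

  1≰0 : ¬ 1# ≤ 0#
  1≰0 1≤0 = 0≉1 (antisym 0≤1 1≤0)

  x²≤0⇒x≈0 : ∀ x → x * x ≤ 0# → x ≈ 0#
  x²≤0⇒x≈0 x x²≤0 with x ≟ 0#
  ... | yes x≈0 = x≈0
  ... | no  x≉0 = contradiction (≤-respˡ-≈ eq (≤-respʳ-≈ (zeroʳ _)
                    (*-monoˡ-≤ (0≤x² (x ⁻¹)) x²≤0))) 1≰0
    where
    eq : (x ⁻¹ * x ⁻¹) * (x * x) ≈ 1#
    eq = begin
      (x ⁻¹ * x ⁻¹) * (x * x) ≈⟨ solve 2 (λ u v → (u :* u) :* (v :* v) := (v :* u) :* (v :* u)) refl (x ⁻¹) x ⟩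
      (x * x ⁻¹) * (x * x ⁻¹) ≈⟨ *-cong (⁻¹-inverseʳ x x≉0) (⁻¹-inverseʳ x x≉0) ⟩
      1# * 1#                 ≈⟨ *-identityˡ 1# ⟩
      1#                      ∎

  ⁻¹-nonNegative : ∀ {x} → 0# ≤ x → ¬ x ≈ 0# → 0# ≤ x ⁻¹
  ⁻¹-nonNegative {x} 0≤x x≉0 = ≤-respʳ-≈ eq (*-nonNegative 0≤x (0≤x² (x ⁻¹)))
    where
    eq : x * (x ⁻¹ * x ⁻¹) ≈ x ⁻¹
    eq = trans (sym (*-assoc _ _ _)) (trans (*-congʳ (⁻¹-inverseʳ x x≉0)) (*-identityˡ _))

  x²≤y²⇒x≤y : ∀ {x y} → 0# ≤ y → x * x ≤ y * y → x ≤ y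
  x²≤y²⇒x≤y {x} {y} 0≤y x²≤y² with total x y
  ... | inj₁ x≤y = x≤y
  ... | inj₂ y≤x = ≤-reflexive (begin
    x     ≈⟨ x+[y-x]≈y y x ⟨
    y + t ≈⟨ +-congˡ (x²≤0⇒x≈0 t (≤-trans t²≤2yt+t² (x+y≤x⇒y≤0 (y * y) (≤-respˡ-≈ eq x²≤y²)))) ⟩
    y + 0# ≈⟨ +-identityʳ y ⟩
    y     ∎)
    where
    t : Carrier
    t = x - y
    0≤yt : 0# ≤ y * t
    0≤yt = *-nonNegative 0≤y (x≤y⇒0≤y-x y≤x)
    t²≤2yt+t² : t * t ≤ t * t + (y * t + y * t)
    t²≤2yt+t² = x≤x+y (t * t) (+-nonNegative 0≤yt 0≤yt)
    eq : x * x ≈ y * y + (t * t + (y * t + y * t))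
    eq = begin
      x * x             ≈⟨ *-cong (x+[y-x]≈y y x) (x+[y-x]≈y y x) ⟨
      (y + t) * (y + t) ≈⟨ solve 2 (λ y t → (y :+ t) :* (y :+ t) := y :* y :+ (t :* t :+ (y :* t :+ y :* t))) refl y t ⟩
      y * y + (t * t + (y * t + y * t)) ∎

  private
    identity₁ : ∀ a → a + (a * a + a + 1#) ≈ (a + 1#) * (a + 1#)
    identity₁ a = begin
      a + (a * a + a + 1#)           ≈⟨ +-congˡ (+-assoc (a * a) a 1#) ⟩
      a + (a * a + (a + 1#))         ≈⟨ +-assoc a (a * a) (a + 1#) ⟨
      a + a * a + (a + 1#)           ≈⟨ +-congʳ (+-comm a (a * a)) ⟩
      a * a + a + (a + 1#)           ≈⟨ +-cong (+-congˡ (*-identityʳ a)) (*-identityˡ (a + 1#)) ⟨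
      a * a + a * 1# + 1# * (a + 1#) ≈⟨ +-congʳ (distribˡ a a 1#) ⟨
      a * (a + 1#) + 1# * (a + 1#)   ≈⟨ distribʳ (a + 1#) a 1# ⟨
      (a + 1#) * (a + 1#)            ∎

    identity₂ : ∀ x d → d + (x + 1#) ≈ x + (1# + d)
    identity₂ x d = trans (+-comm d (x + 1#)) (+-assoc x 1# d)

    identity₃ : ∀ s t → (s + t) * (s + t) ≈ s * s + t * ((s + s) + t)
    identity₃ = solve 2 (λ s t → (s :+ t) :* (s :+ t) := s :* s :+ t :* ((s :+ s) :+ t)) refl

    identity₄ : ∀ y t → y * t + y * t + t * t + y * y ≈ (y + t) * (y + t)
    identity₄ = solve 2 (λ y t → y :* t :+ y :* t :+ t :* t :+ y :* y := (y :+ t) :* (y :+ t)) refl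

    identity₅ : ∀ a y t → a + ((y + t) + (y + t)) * t ≈ (y * t + y * t + t * t) + (a + t * t)
    identity₅ = solve 3 (λ a y t → a :+ ((y :+ t) :+ (y :+ t)) :* t := (y :* t :+ y :* t :+ t :* t) :+ (a :+ t :* t)) refl

  abstract
    squareRoot : ∀ a → 0# ≤ a → ∃ λ s → 0# ≤ s × s * s ≈ a
    squareRoot a 0≤a = s , 0≤s , antisym s²≤a a≤s²
      where
      P : Pred Carrier 0ℓ
      P x = x * x ≤ a

      0∈P : P 0#
      0∈P = ≤-respˡ-≈ (sym (zeroˡ 0#)) 0≤a

      bounded : UpperBound P (a + 1#)
      bounded x x²≤a = x²≤y²⇒x≤y (+-nonNegative 0≤a 0≤1) (≤-trans x²≤a (≤-respʳ-≈ eq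
        (x≤x+y a (+-nonNegative (+-nonNegative (0≤x² a) 0≤a) 0≤1))))
        where
        eq : a + (a * a + a + 1#) ≈ (a + 1#) * (a + 1#)
        eq = identity₁ a

      sup : ∃ λ s → UpperBound P s × (∀ b → UpperBound P b → s ≤ b)
      sup = supremum P (0# , 0∈P) (a + 1# , bounded)

      s : Carrier
      s = proj₁ sup

      0≤s : 0# ≤ s
      0≤s = proj₁ (proj₂ sup) 0# 0∈P

      a≤s² : a ≤ s * s
      a≤s² with total a (s * s)
      ... | inj₁ a≤s² = a≤s²
      ... | inj₂ s²≤a = ≤-reflexive (begin
        a             ≈⟨ x+[y-x]≈y (s * s) a ⟨
        s * s + δ     ≈⟨ +-congˡ δ≈kt ⟩
        s * s + k * t ≈⟨ +-congˡ (*-congˡ t≈0) ⟩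
        s * s + k * 0# ≈⟨ +-congˡ (zeroʳ k) ⟩
        s * s + 0#    ≈⟨ +-identityʳ (s * s) ⟩
        s * s         ∎)
        where
        δ k t : Carrier
        δ = a - s * s
        k = (s + s) + (1# + δ)
        t = k ⁻¹ * δ
        0≤δ : 0# ≤ δ
        0≤δ = x≤y⇒0≤y-x s²≤a
        0≤2s : 0# ≤ s + s
        0≤2s = +-nonNegative 0≤s 0≤s
        1≤k : 1# ≤ k
        1≤k = ≤-respˡ-≈ (+-identityˡ 1#) (+-mono-≤ 0≤2s (x≤x+y 1# 0≤δ))
        δ≤k : δ ≤ k
        δ≤k = ≤-respʳ-≈ (identity₂ (s + s) δ)
                (x≤x+y δ (+-nonNegative 0≤2s 0≤1))
        k≉0 : ¬ k ≈ 0#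
        k≉0 k≈0 = 1≰0 (≤-respʳ-≈ k≈0 1≤k)
        0≤k⁻¹ : 0# ≤ k ⁻¹
        0≤k⁻¹ = ⁻¹-nonNegative (≤-trans 0≤1 1≤k) k≉0
        0≤t : 0# ≤ t
        0≤t = *-nonNegative 0≤k⁻¹ 0≤δ
        t≤1 : t ≤ 1#
        t≤1 = ≤-respʳ-≈ (trans (*-comm _ _) (⁻¹-inverseʳ k k≉0)) (*-monoˡ-≤ 0≤k⁻¹ δ≤k)
        δ≈kt : δ ≈ k * t
        δ≈kt = begin
          δ              ≈⟨ *-identityˡ δ ⟨
          1# * δ         ≈⟨ *-congʳ (⁻¹-inverseʳ k k≉0) ⟨
          k * k ⁻¹ * δ   ≈⟨ *-assoc k (k ⁻¹) δ ⟩
          k * (k ⁻¹ * δ) ∎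
        s+t∈P : P (s + t)
        s+t∈P = ≤-respˡ-≈ (sym (identity₃ s t))
          (≤-respʳ-≈ (trans (+-congˡ (trans (*-comm t k) (sym δ≈kt))) (x+[y-x]≈y (s * s) a))
            (+-monoʳ-≤ (s * s) (*-monoˡ-≤ 0≤t
              (+-monoʳ-≤ (s + s) (≤-trans t≤1 (x≤x+y 1# 0≤δ))))))
        t≈0 : t ≈ 0#
        t≈0 = antisym (x+y≤x⇒y≤0 s (proj₁ (proj₂ sup) (s + t) s+t∈P)) 0≤t

      s²≤a : s * s ≤ a
      s²≤a with s ≟ 0# | total (s * s) a
      ... | _       | inj₁ s²≤a = s²≤a
      ... | yes s≈0 | _ = ≤-respˡ-≈ (sym (trans (*-congʳ s≈0) (zeroˡ s))) 0≤a
      ... | no  s≉0 | inj₂ a≤s² = ≤-reflexive (begin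
        s * s      ≈⟨ x+[y-x]≈y a (s * s) ⟨
        a + δ      ≈⟨ +-congˡ δ≈kt ⟩
        a + k * t  ≈⟨ +-congˡ (*-congˡ t≈0) ⟩
        a + k * 0# ≈⟨ +-congˡ (zeroʳ k) ⟩
        a + 0#     ≈⟨ +-identityʳ a ⟩
        a          ∎)
        where
        δ k t y : Carrier
        δ = s * s - a
        k = s + s
        t = k ⁻¹ * δ
        y = s - t
        0≤δ : 0# ≤ δ
        0≤δ = x≤y⇒0≤y-x a≤s²
        s≤k : s ≤ k
        s≤k = x≤x+y s 0≤s
        k≉0 : ¬ k ≈ 0#
        k≉0 k≈0 = s≉0 (antisym (≤-respʳ-≈ k≈0 s≤k) 0≤s)
        0≤k⁻¹ : 0# ≤ k ⁻¹
        0≤k⁻¹ = ⁻¹-nonNegative (≤-trans 0≤s s≤k) k≉0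
        0≤t : 0# ≤ t
        0≤t = *-nonNegative 0≤k⁻¹ 0≤δ
        δ≈kt : δ ≈ k * t
        δ≈kt = begin
          δ              ≈⟨ *-identityˡ δ ⟨
          1# * δ         ≈⟨ *-congʳ (⁻¹-inverseʳ k k≉0) ⟨
          k * k ⁻¹ * δ   ≈⟨ *-assoc k (k ⁻¹) δ ⟩
          k * (k ⁻¹ * δ) ∎
        δ≤ks : δ ≤ k * s
        δ≤ks = ≤-trans (≤-respʳ-≈ (x+[y-x]≈y a (s * s)) (≤-respˡ-≈ (+-identityˡ δ) (+-mono-≤ 0≤a ≤-refl)))
          (≤-respʳ-≈ (sym (distribʳ s s s)) (x≤x+y (s * s) (0≤x² s)))
        t≤s : t ≤ s
        t≤s = ≤-respʳ-≈ (trans (sym (*-assoc _ _ _))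
                  (trans (*-congʳ (trans (*-comm _ _) (⁻¹-inverseʳ k k≉0))) (*-identityˡ s)))
                (*-monoˡ-≤ 0≤k⁻¹ δ≤ks)
        y+t≈s : y + t ≈ s
        y+t≈s = trans (+-comm y t) (x+[y-x]≈y t s)
        y²≈a+t² : y * y ≈ a + t * t
        y²≈a+t² = ∙-cancelˡ (y * t + y * t + t * t) _ _ (begin
          y * t + y * t + t * t + y * y
            ≈⟨ identity₄ y t ⟩
          (y + t) * (y + t)
            ≈⟨ *-cong y+t≈s y+t≈s ⟩
          s * s
            ≈⟨ x+[y-x]≈y a (s * s) ⟨
          a + δ
            ≈⟨ +-congˡ δ≈kt ⟩
          a + (s + s) * t
            ≈⟨ +-congˡ (*-congʳ (+-cong y+t≈s y+t≈s)) ⟨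
          a + ((y + t) + (y + t)) * t
            ≈⟨ identity₅ a y t ⟩
          (y * t + y * t + t * t) + (a + t * t) ∎)
        y-bound : UpperBound P y
        y-bound x x²≤a = x²≤y²⇒x≤y (x≤y⇒0≤y-x t≤s)
          (≤-trans x²≤a (≤-respʳ-≈ (sym y²≈a+t²) (x≤x+y a (0≤x² t))))
        t≈0 : t ≈ 0#
        t≈0 = antisym (x+y≤x⇒y≤0 y (≤-respˡ-≈ (sym y+t≈s) (proj₂ (proj₂ sup) y y-bound))) 0≤t

  -- Total, with the convention √ a = 0 for a < 0.
  √_ : Carrier → Carrier
  √ a with 0# ≤? a
  ... | yes 0≤a = proj₁ (squareRoot a 0≤a)
  ... | no  _   = 0#

  √-nonNegative : ∀ a → 0# ≤ √ a
  √-nonNegative a with 0# ≤? a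
  ... | yes 0≤a = proj₁ (proj₂ (squareRoot a 0≤a))
  ... | no  _   = ≤-refl

  √-square : ∀ {a} → 0# ≤ a → √ a * √ a ≈ a
  √-square {a} 0≤a with 0# ≤? a
  ... | yes 0≤a = proj₂ (proj₂ (squareRoot a 0≤a))
  ... | no  0≰a = contradiction 0≤a 0≰a

  √-negative : ∀ {a} → ¬ 0# ≤ a → √ a ≈ 0#
  √-negative {a} 0≰a with 0# ≤? a
  ... | yes 0≤a = contradiction 0≤a 0≰a
  ... | no  _   = refl

  √-cong : ∀ {a b} → a ≈ b → √ a ≈ √ b
  √-cong {a} {b} a≈b = byCases (0# ≤? a)
    where
    byCases : Dec (0# ≤ a) → √ a ≈ √ b
    byCases (no 0≰a) = trans (√-negative 0≰a)
      (sym (√-negative (λ 0≤b → 0≰a (≤-respʳ-≈ (sym a≈b) 0≤b))))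
    byCases (yes 0≤a) = antisym
      (x²≤y²⇒x≤y (√-nonNegative b) (≤-reflexive a²≈b²))
      (x²≤y²⇒x≤y (√-nonNegative a) (≤-reflexive (sym a²≈b²)))
      where
      a²≈b² : √ a * √ a ≈ √ b * √ b
      a²≈b² = trans (√-square 0≤a) (trans a≈b (sym (√-square (≤-respʳ-≈ a≈b 0≤a))))

Sym : Setoid 0ℓ 0ℓ → Group 0ℓ 0ℓ
Sym S = record
  { Carrier = Inverse S S
  ; _≈_     = λ f g → ∀ x → to f x ≈ to g x
  ; _∙_     = λ f g → Composition.inverse g f
  ; ε       = Identity.inverse S
  ; _⁻¹     = Symmetry.inverse
  ; isGroup = record
    { isMonoid = record
      { isSemigroup = record
        { isMagma = record
          { isEquivalence = record
            { refl  = λ _ → refl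
            ; sym   = λ f≈g x → sym (f≈g x)
            ; trans = λ f≈g g≈h x → trans (f≈g x) (g≈h x)
            }
          ; ∙-cong = λ {f} {f′} {g} {g′} f≈f′ g≈g′ x →
              trans (to-cong f (g≈g′ x)) (f≈f′ (to g′ x))
          }
        ; assoc = λ _ _ _ _ → refl
        }
      ; identity = (λ _ _ → refl) , (λ _ _ → refl)
      }
    ; inverse = (λ f _ → inverseʳ f refl) , (λ f _ → inverseˡ f refl)
    ; ⁻¹-cong = λ {f} {g} → from-≈ f g
    }
  }
  where
  open Setoid S
  open Inverse
  from-≈ : ∀ (f g : Inverse S S) → (∀ x → to f x ≈ to g x) → ∀ x → from f x ≈ from g x
  from-≈ f g f≈g x = sym (inverseʳ g (trans (sym (inverseˡ f refl)) (f≈g (from f x))))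

module Plane (ℝ : CompleteOrderedField) where

  open RealArithmetic ℝ public

  plane : Setoid 0ℓ 0ℓ
  plane = ×-setoid setoid setoid

  Point : Set
  Point = Setoid.Carrier plane

  dist : Point → Point → Carrier
  dist (x₁ , y₁) (x₂ , y₂) = √ ((x₁ - x₂) * (x₁ - x₂) + (y₁ - y₂) * (y₁ - y₂))

  dist-cong : ∀ {A A′ B B′} → Setoid._≈_ plane A A′ → Setoid._≈_ plane B B′ →
              dist A B ≈ dist A′ B′
  dist-cong (x₁≈ , y₁≈) (x₂≈ , y₂≈) =
    √-cong (+-cong (*-cong Δx≈ Δx≈) (*-cong Δy≈ Δy≈))
    where
    Δx≈ = +-cong x₁≈ (-‿cong x₂≈)
    Δy≈ = +-cong y₁≈ (-‿cong y₂≈)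

  record Isometry : Set where
    field
      bijection : Inverse plane plane
    open Inverse bijection public
    field
      isometric : ∀ A B → dist (to A) (to B) ≈ dist A B

  open Isometry using (bijection)

  -- The group E(2) of Euclidean isometries of the plane.
  E₂ : Group 0ℓ 0ℓ
  E₂ = record
    { Carrier = Isometry
    ; _≈_     = λ S T → bijection S B.≈ bijection T
    ; _∙_     = λ S T → record
      { bijection = bijection S B.∙ bijection T
      ; isometric = λ P Q → trans (Isometry.isometric S _ _) (Isometry.isometric T P Q)
      }
    ; ε       = record { bijection = B.ε ; isometric = λ _ _ → refl }
    ; _⁻¹     = λ T → record
      { bijection = bijection T B.⁻¹
      ; isometric = λ P Q → let open Isometry T in
          trans (sym (isometric (from P) (from Q)))
                (dist-cong (strictlyInverseˡ P) (strictlyInverseˡ Q))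
      }
    ; isGroup = record
      { isMonoid = record
        { isSemigroup = record
          { isMagma = record
            { isEquivalence = record
              { refl  = λ {T} → B.refl {bijection T}
              ; sym   = λ {S} {T} → B.sym {bijection S} {bijection T}
              ; trans = λ {S} {T} {W} → B.trans {bijection S} {bijection T} {bijection W}
              }
            ; ∙-cong = λ {S} {S′} {T} {T′} →
                B.∙-cong {bijection S} {bijection S′} {bijection T} {bijection T′}
            }
          ; assoc = λ S T W → B.assoc (bijection S) (bijection T) (bijection W)
          }
        ; identity = (λ T → B.identityˡ (bijection T)) , (λ T → B.identityʳ (bijection T))
        }
      ; inverse = (λ T → B.inverseˡ (bijection T)) , (λ T → B.inverseʳ (bijection T))
      ; ⁻¹-cong = λ {S} {T} → B.⁻¹-cong {bijection S} {bijection T}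
      }
    }
    where
    module B = Group (Sym plane)

  S₄×E₂ : Group 0ℓ 0ℓ
  S₄×E₂ = group (Sym (≡.setoid (Fin 4))) E₂

  record ProperColouring (k : ℕ) : Set where
    field
      colouring : Func plane (≡.setoid (Fin k))
    open Func colouring public renaming (to to colour; cong to colour-cong)
    field
      proper : ∀ A B → dist A B ≈ 1# → colour A ≢ colour B

  -- Subsets of a group.  Group elements are compared up to the group's own
  -- equality, so a predicate denotes a subset only if it respects it.
  record Event (G : Group 0ℓ 0ℓ) : Set₁ where
    open Group G using () renaming (Carrier to ∣G∣; _≈_ to _≈ᴳ_)
    field
      holds    : Pred ∣G∣ 0ℓ
      respects : holds Respects _≈ᴳ_

  open Event public

  everything : ∀ G → Event G
  everything G = record { holds = λ _ → ⊤ ; respects = λ _ _ → _ }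

  union : ∀ {G} → Event G → Event G → Event G
  union {G} E F = record
    { holds    = holds E ∪ holds F
    ; respects = λ x≈y → Sum.map (respects E x≈y) (respects F x≈y)
    }

  -- gE = { g e ∣ e ∈ E }
  leftTranslate : ∀ {G} → Group.Carrier G → Event G → Event G
  leftTranslate {G} g E = record
    { holds    = λ x → ∃ λ e → holds E e × x ≈ᴳ g ∙ e
    ; respects = λ x≈y (e , e∈E , x≈ge) → e , e∈E , Group.trans G (Group.sym G x≈y) x≈ge
    }
    where open Group G using (_∙_) renaming (_≈_ to _≈ᴳ_)

  record LeftInvariantProbability (G : Group 0ℓ 0ℓ) : Set₁ where
    field
      μ             : Event G → Carrier
      μ-cong        : ∀ E F → holds E ≐ holds F → μ E ≈ μ F
      nonNegative   : ∀ E → 0# ≤ μ E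
      normalised    : μ (everything G) ≈ 1#
      additive      : ∀ E F → holds E ⊥ holds F → μ (union E F) ≈ μ E + μ F
      leftInvariant : ∀ g E → μ (leftTranslate g E) ≈ μ E

  module _ (c₀ : ProperColouring 4) where

    open ProperColouring c₀

    -- c = σ ∘ c₀ ∘ T⁻¹
    randomColouring : Group.Carrier S₄×E₂ → Point → Fin 4
    randomColouring (σ , T) A = Inverse.to σ (colour (Isometry.from T A))

    sameColour : Point → Point → Event S₄×E₂
    sameColour A B = record
      { holds    = λ g → randomColouring g A ≡ randomColouring g B
      ; respects = λ {g} {h} g≈h eq →
          ≡.trans (≡.sym (cong g h g≈h A)) (≡.trans eq (cong g h g≈h B))
      }
      where
      open Group S₄×E₂ using () renaming (_≈_ to _≈ᴳ_)
      cong : ∀ g h → g ≈ᴳ h → ∀ P → randomColouring g P ≡ randomColouring h P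
      cong (σ , S) (τ , T) (σ≈τ , S≈T) P = ≡.trans (σ≈τ _)
        (≡.cong (Inverse.to τ) (colour-cong (Group.⁻¹-cong E₂ {S} {T} S≈T P)))

  -- The probability that A and B receive the same colour.  By left-invariance
  -- it depends only on dist A B; p_d is its value for any A, B at distance d.
  monochromaticity : ProperColouring 4 → LeftInvariantProbability S₄×E₂ →
                     Point → Point → Carrier
  monochromaticity c₀ P A B = LeftInvariantProbability.μ P (sameColour c₀ A B)

{-# OPTIONS --safe #-}
-- Write p_r for the probability that two points at distance r agree, so p₁ = 0.
-- Let {s, t} = {1, d}, let w, w′ have length s and ∣w - w′∣ = t, put w″ = w - w′,
-- and let ρ be the rotation by 60°.
--
-- Spindle: in an isosceles triangle with legs r ≥ s/2 and base s, both legs are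
-- monochromatic only if the base is, so 2 p_r ≤ 1 + p_s.
--
-- For {p, q} two of w, w′, ±w″, the points 0, p, ρp, q, ρq span a K₅ all of whose edges,
-- other than the diagonals p-ρq and ρp-q, have length s or t.  With four colours and
-- properly coloured edges at least one diagonal is monochromatic; the diagonals have
-- length ≥ s/2, so by the spindle bound almost surely exactly one is (up to multiples
-- of p_s and p_t).  In that case the permutation of the three colours different from
-- that of 0 which carries p to q, a 3-cycle, also carries ρp to ρq.  Going three steps
-- along ρ, the same 3-cycle relates p to q and -p to -q.  Doing this for (w, w′),
-- (w, w″) and (w′, -w″) forces w and -w to have the same colour, against the spindle
-- bound p_{2s} ≤ (1 + p_s)/2.  Quantitatively, 1 ≤ 211 p_s + 96 p_t.
--
-- The shorter diagonal is at least s/2 for (s, t) = (1, d) when d ≤ 1/2, and for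
-- (s, t) = (d, 1) when 1/2 ≤ d and 9d⁴ - 36d² + 16 ≥ 0, i.e. d ≤ (√5 - 1)/√3.
module Submission where

open import Defs
open import Algebra.Bundles using (CommutativeRing; Group)
import Algebra.Solver.Ring
open import Algebra.Solver.Ring.AlmostCommutativeRing
  using (fromCommutativeRing; _-Raw-AlmostCommutative⟶_)
open import Data.Fin.Base using (Fin)
open import Data.Fin.Patterns using (0F; 1F; 2F; 3F)
import Data.Fin.Properties as Fin
open import Data.Integer.Base as ℤ using (ℤ; -[1+_])
import Data.Integer.Properties as ℤ
open import Data.List.Base as List using (List; []; _∷_; _++_; foldr; replicate)
open import Data.Maybe.Base as Maybe using (Maybe)
open import Data.Nat.Base as ℕ using (ℕ; zero; suc; z≤n; s≤s)
import Data.Nat.Properties as ℕ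
open import Data.Product.Base using (∃; _×_; _,_; proj₁; proj₂)
open import Data.Sum.Base using (_⊎_; inj₁; inj₂)
open import Function.Base using (id)
open import Function.Bundles using (Func; Inverse)
import Function.Construct.Identity as Identity
open import Level using (0ℓ)
open import Relation.Binary.Bundles using (Setoid)
open import Relation.Binary.PropositionalEquality as ≡ using (_≡_; _≢_)
open import Relation.Nullary.Decidable
  using (Dec; yes; no; _×-dec_; _⊎-dec_; _→-dec_; ¬?; dec⇒maybe; toWitness)
open import Relation.Nullary.Negation.Core using (¬_; contradiction)
open import Relation.Unary using (Decidable)

-- A ring solver with integer coefficients.

module IntegerSolver (R : CommutativeRing 0ℓ 0ℓ) where

  open CommutativeRing R
  open import Data.Integer.Base using (+_)
  open import Algebra.Properties.Ring ring
    using (-‿distribˡ-*; -‿distribʳ-*; -‿involutive)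
  open import Algebra.Properties.AbelianGroup +-abelianGroup
    using (⁻¹-∙-comm; ε⁻¹≈ε)
  open import Algebra.Properties.Semiring.Mult.TCOptimised semiring
    using (×-homo-+; ×1-homo-*) renaming (_×_ to _times_)
  open import Relation.Binary.Reasoning.Setoid setoid

  fromℤ : ℤ → Carrier
  fromℤ (+ n)    = n times 1#
  fromℤ -[1+ n ] = - (suc n times 1#)

  private

    neg-homo : ∀ i → fromℤ (ℤ.- i) ≈ - fromℤ i
    neg-homo -[1+ n ]    = sym (-‿involutive _)
    neg-homo (+ zero)    = sym ε⁻¹≈ε
    neg-homo (+ (suc n)) = refl

    ∸-homo : ∀ {m n} → n ℕ.≤ m → (m ℕ.∸ n) times 1# ≈ m times 1# - n times 1#
    ∸-homo {m} {n} n≤m = begin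
      (m ℕ.∸ n) times 1#                     ≈⟨ +-identityʳ _ ⟨
      (m ℕ.∸ n) times 1# + 0#                ≈⟨ +-congˡ (-‿inverseʳ _) ⟨
      (m ℕ.∸ n) times 1# + (n times 1# - n times 1#) ≈⟨ +-assoc _ _ _ ⟨
      (m ℕ.∸ n) times 1# + n times 1# - n times 1#   ≈⟨ +-congʳ (×-homo-+ 1# (m ℕ.∸ n) n) ⟨
      (m ℕ.∸ n ℕ.+ n) times 1# - n times 1#      ≡⟨ ≡.cong (λ k → k times 1# - n times 1#) (ℕ.m∸n+n≡m n≤m) ⟩
      m times 1# - n times 1#                    ∎

    ⊖-homo : ∀ m n → fromℤ (m ℤ.⊖ n) ≈ m times 1# - n times 1#
    ⊖-homo m n with ℕ.≤-total n m
    ... | inj₁ n≤m = trans (reflexive (≡.cong fromℤ (ℤ.⊖-≥ n≤m))) (∸-homo n≤m)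
    ... | inj₂ m≤n = begin
      fromℤ (m ℤ.⊖ n)             ≡⟨ ≡.cong fromℤ (ℤ.⊖-≤ m≤n) ⟩
      fromℤ (ℤ.- (+ (n ℕ.∸ m)))   ≈⟨ neg-homo (+ (n ℕ.∸ m)) ⟩
      - ((n ℕ.∸ m) times 1#)          ≈⟨ -‿cong (∸-homo m≤n) ⟩
      - (n times 1# - m times 1#)         ≈⟨ ⁻¹-∙-comm _ _ ⟨
      - (n times 1#) + - - (m times 1#)   ≈⟨ +-congˡ (-‿involutive _) ⟩
      - (n times 1#) + m times 1#         ≈⟨ +-comm _ _ ⟩
      m times 1# - n times 1#             ∎

    +-homo : ∀ i j → fromℤ (i ℤ.+ j) ≈ fromℤ i + fromℤ j
    +-homo (+ m)    (+ n)    = ×-homo-+ 1# m n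
    +-homo (+ m)    -[1+ n ] = ⊖-homo m (suc n)
    +-homo -[1+ m ] (+ n)    = trans (⊖-homo n (suc m)) (+-comm _ _)
    +-homo -[1+ m ] -[1+ n ] = begin
      - ((2 ℕ.+ (m ℕ.+ n)) times 1#)       ≡⟨ ≡.cong (λ k → - (suc k times 1#)) (ℕ.+-suc m n) ⟨
      - ((suc m ℕ.+ suc n) times 1#)       ≈⟨ -‿cong (×-homo-+ 1# (suc m) (suc n)) ⟩
      - (suc m times 1# + suc n times 1#)      ≈⟨ ⁻¹-∙-comm _ _ ⟨
      - (suc m times 1#) - suc n times 1#      ∎

    *-homo : ∀ i j → fromℤ (i ℤ.* j) ≈ fromℤ i * fromℤ j
    *-homo (+ m)    (+ n)    = trans (reflexive (≡.cong fromℤ (ℤ.+◃n≡+n (m ℕ.* n)))) (×1-homo-* m n)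
    *-homo (+ m)    -[1+ n ] = begin
      fromℤ (+ m ℤ.* -[1+ n ])          ≡⟨ ≡.cong fromℤ (ℤ.neg-distribʳ-* (+ m) (+ suc n)) ⟨
      fromℤ (ℤ.- (+ m ℤ.* + suc n))     ≈⟨ neg-homo (+ m ℤ.* + suc n) ⟩
      - fromℤ (+ m ℤ.* + suc n)         ≈⟨ -‿cong (*-homo (+ m) (+ suc n)) ⟩
      - (m times 1# * (suc n times 1#))         ≈⟨ -‿distribʳ-* _ _ ⟩
      m times 1# * - (suc n times 1#)           ∎
    *-homo -[1+ m ] (+ n)    = begin
      fromℤ (-[1+ m ] ℤ.* + n)          ≡⟨ ≡.cong fromℤ (ℤ.neg-distribˡ-* (+ suc m) (+ n)) ⟨
      fromℤ (ℤ.- (+ suc m ℤ.* + n))     ≈⟨ neg-homo (+ suc m ℤ.* + n) ⟩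
      - fromℤ (+ suc m ℤ.* + n)         ≈⟨ -‿cong (*-homo (+ suc m) (+ n)) ⟩
      - (suc m times 1# * (n times 1#))         ≈⟨ -‿distribˡ-* _ _ ⟩
      - (suc m times 1#) * (n times 1#)         ∎
    *-homo -[1+ m ] -[1+ n ] = begin
      (suc m ℕ.* suc n) times 1#            ≈⟨ ×1-homo-* (suc m) (suc n) ⟩
      suc m times 1# * (suc n times 1#)         ≈⟨ -‿involutive _ ⟨
      - - (suc m times 1# * (suc n times 1#))   ≈⟨ -‿cong (-‿distribʳ-* _ _) ⟩
      - (suc m times 1# * - (suc n times 1#))   ≈⟨ -‿distribˡ-* _ _ ⟩
      - (suc m times 1#) * - (suc n times 1#)   ∎

    homomorphism : ℤ.+-*-rawRing -Raw-AlmostCommutative⟶ fromCommutativeRing R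
    homomorphism = record
      { ⟦_⟧    = fromℤ
      ; +-homo = +-homo
      ; *-homo = *-homo
      ; -‿homo = neg-homo
      ; 0-homo = refl
      ; 1-homo = refl
      }

    _coeff≟_ : ∀ i j → Maybe (fromℤ i ≈ fromℤ j)
    i coeff≟ j = Maybe.map (λ i≡j → reflexive (≡.cong fromℤ i≡j)) (dec⇒maybe (i ℤ.≟ j))

  open Algebra.Solver.Ring ℤ.+-*-rawRing (fromCommutativeRing R) homomorphism _coeff≟_ public
    using (Polynomial; con; solve; _:=_; _:+_; _:*_; _:-_; :-_)

  num : ∀ {n} → ℕ → Polynomial n
  num k = con (+ k)

  -- Denotes fromℕ k definitionally, unlike num k.
  nat : ∀ {n} → ℕ → Polynomial n
  nat zero    = num 0
  nat (suc k) = num 1 :+ nat k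

-- Expected counts under a finitely additive measure.

indicator : ∀ {p} {P : Set p} → Dec P → ℕ
indicator (yes _) = 1
indicator (no _)  = 0

indicator-≤1 : ∀ {p} {A : Set p} (A? : Dec A) → indicator A? ℕ.≤ 1
indicator-≤1 (yes _) = ℕ.≤-refl
indicator-≤1 (no _)  = z≤n

module Domination (ℝ : CompleteOrderedField) (G : Group 0ℓ 0ℓ)
                  (P : Plane.LeftInvariantProbability ℝ G) where

  open Plane ℝ
  open LeftInvariantProbability P
  open Group G using () renaming (Carrier to ∣G∣; sym to symᴳ)
  open import Relation.Binary.Reasoning.Setoid setoid

  -- Membership is decidable so that events can be counted pointwise and split constructively;
  -- equality of two colours qualifies.
  record DecEvent : Set₁ where
    field
      event  : Event G
      holds? : Decidable (holds event)

  open DecEvent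

  infixr 6 _∩_ _∖_

  _∩_ _∖_ : DecEvent → DecEvent → DecEvent
  E ∩ F = record
    { event = record
      { holds    = λ g → holds (event E) g × holds (event F) g
      ; respects = λ g≈h (e , f) → respects (event E) g≈h e , respects (event F) g≈h f
      }
    ; holds? = λ g → holds? E g ×-dec holds? F g
    }
  E ∖ F = record
    { event = record
      { holds    = λ g → holds (event E) g × ¬ holds (event F) g
      ; respects = λ g≈h (e , ¬f) → respects (event E) g≈h e , λ f → ¬f (respects (event F) (symᴳ g≈h) f)
      }
    ; holds? = λ g → holds? E g ×-dec ¬? (holds? F g)
    }

  prob : DecEvent → Carrier
  prob E = μ (event E)

  prob-split : ∀ E F → prob E ≈ prob (E ∩ F) + prob (E ∖ F)
  prob-split E F = trans
    (μ-cong (event E) (union (event (E ∩ F)) (event (E ∖ F))) (⊆∪ , ∪⊆))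
    (additive (event (E ∩ F)) (event (E ∖ F)) λ ((_ , f) , (_ , ¬f)) → ¬f f)
    where
    ⊆∪ : ∀ {g} → holds (event E) g → holds (union (event (E ∩ F)) (event (E ∖ F))) g
    ⊆∪ {g} e with holds? F g
    ... | yes f = inj₁ (e , f)
    ... | no ¬f = inj₂ (e , ¬f)
    ∪⊆ : ∀ {g} → holds (union (event (E ∩ F)) (event (E ∖ F))) g → holds (event E) g
    ∪⊆ (inj₁ (e , _)) = e
    ∪⊆ (inj₂ (e , _)) = e

  count : List DecEvent → ∣G∣ → ℕ
  count []       g = 0
  count (E ∷ Es) g = indicator (holds? E g) ℕ.+ count Es g

  expected : List DecEvent → Carrier
  expected = foldr (λ E x → prob E + x) 0#

  expected-nonNegative : ∀ Es → 0# ≤ expected Es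
  expected-nonNegative []       = ≤-refl
  expected-nonNegative (E ∷ Es) = +-nonNegative (nonNegative (event E)) (expected-nonNegative Es)

  -- An empty event is disjoint from itself and equals its union with itself, so additivity gives
  -- `μ E ≈ μ E + μ E`.
  prob-empty : ∀ E → (∀ g → ¬ holds (event E) g) → prob E ≈ 0#
  prob-empty E empty = antisym
    (x+y≤x⇒y≤0 (prob E) (≤-reflexive (sym (trans
      (μ-cong (event E) (union (event E) (event E)) ((λ e → inj₁ e) , (λ { (inj₁ e) → e ; (inj₂ e) → e })))
      (additive (event E) (event E) (λ {g} (e , _) → empty g e))))))
    (nonNegative (event E))

  -- Each F in turn gives up what it covers of the part of E still left.
  remove : DecEvent → List DecEvent → List DecEvent
  remove E []       = []
  remove E (F ∷ Fs) = (F ∖ E) ∷ remove (E ∖ F) Fs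

  Covers : List DecEvent → DecEvent → Set
  Covers Fs E = ∀ g → holds (event E) g → 1 ℕ.≤ count Fs g

  covers-rest : ∀ {E F Fs} → Covers (F ∷ Fs) E → Covers Fs (E ∖ F)
  covers-rest {F = F} cov g (e , ¬f) with holds? F g | cov g e
  ... | yes f | _ = contradiction f ¬f
  ... | no  _ | c = c

  -- At a point of `E` only the first member of `Fs` containing it loses that point; for the later
  -- members it has already left the part of `E` still to be covered.
  count-remove : ∀ E Fs → Covers Fs E → ∀ g →
                 count Fs g ≡ indicator (holds? E g) ℕ.+ count (remove E Fs) g
  count-remove E [] cov g with holds? E g
  ... | yes e = contradiction (cov g e) λ ()
  ... | no  _ = ≡.refl
  count-remove E (F ∷ Fs) cov g
    with holds? E g | holds? F g | count-remove (E ∖ F) Fs (covers-rest {E} {F} {Fs} cov) g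
  ... | yes _ | yes _ | eq = ≡.cong suc eq
  ... | yes _ | no  _ | eq = eq
  ... | no  _ | yes _ | eq = ≡.cong suc eq
  ... | no  _ | no  _ | eq = eq

  expected-remove : ∀ E Fs → Covers Fs E → expected Fs ≈ prob E + expected (remove E Fs)
  expected-remove E [] cov = begin
    0#          ≈⟨ prob-empty E (λ g e → contradiction (cov g e) λ ()) ⟨
    prob E      ≈⟨ +-identityʳ _ ⟨
    prob E + 0# ∎
  expected-remove E (F ∷ Fs) cov = begin
    prob F + expected Fs
      ≈⟨ +-cong (prob-split F E) (expected-remove (E ∖ F) Fs (covers-rest {E} {F} {Fs} cov)) ⟩
    (prob (F ∩ E) + prob (F ∖ E)) + (prob (E ∖ F) + r)
      ≈⟨ +-congʳ (+-congʳ (μ-cong _ _ ((λ (f , e) → e , f) , (λ (e , f) → f , e)))) ⟩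
    (prob (E ∩ F) + prob (F ∖ E)) + (prob (E ∖ F) + r)
      ≈⟨ regroup _ _ _ _ ⟩
    (prob (E ∩ F) + prob (E ∖ F)) + (prob (F ∖ E) + r)
      ≈⟨ +-congʳ (prob-split E F) ⟨
    prob E + (prob (F ∖ E) + r) ∎
    where
    r = expected (remove (E ∖ F) Fs)
    open import Algebra.Properties.CommutativeSemigroup +-commutativeSemigroup
      using () renaming (interchange to regroup)

  -- Monotonicity of expectation without an integral: each `E` in turn is carved out of `Fs`, which
  -- covers it because the counts dominate, and cancelling its indicator restores the hypothesis for
  -- the rest.
  dominated : ∀ Es Fs → (∀ g → count Es g ℕ.≤ count Fs g) → expected Es ≤ expected Fs
  dominated []       Fs le = expected-nonNegative Fs
  dominated (E ∷ Es) Fs le = ≤-respʳ-≈ (sym (expected-remove E Fs cov))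
    (+-monoʳ-≤ (prob E) (dominated Es (remove E Fs) λ g →
      ℕ.+-cancelˡ-≤ (indicator (holds? E g)) _ _
        (≡.subst (count (E ∷ Es) g ℕ.≤_) (count-remove E Fs cov g) (le g))))
    where
    cov : Covers Fs E
    cov g e with holds? E g | le g
    ... | yes _ | c = ℕ.≤-trans (s≤s z≤n) c
    ... | no ¬e | _ = contradiction e ¬e

-- Four-colourings of K₅ and chains of 3-cycles.

module PairCounting where

  open import Data.Nat.Base using (_+_; _≤_)

  private
    variable
      X : Set

  -- The vertex type is arbitrary: points of the plane in the geometry, the colours themselves,
  -- coloured by `id`, in the exhaustive checks.
  monochromatic : (X → Fin 4) → List (X × X) → ℕ
  monochromatic κ []            = 0
  monochromatic κ ((A , B) ∷ L) = indicator (κ A Fin.≟ κ B) + monochromatic κ L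

  monochromatic-++ : ∀ (κ : X → Fin 4) L L′ →
                     monochromatic κ (L ++ L′) ≡ monochromatic κ L + monochromatic κ L′
  monochromatic-++ κ []            L′ = ≡.refl
  monochromatic-++ κ ((A , B) ∷ L) L′ = ≡.trans
    (≡.cong (indicator (κ A Fin.≟ κ B) +_) (monochromatic-++ κ L L′))
    (≡.sym (ℕ.+-assoc (indicator (κ A Fin.≟ κ B)) _ _))

  -- K₅ on z, p, p′, q, q′: the diagonals pq′ and p′q once, every other edge twice.
  edges block : X → X → X → X → X → List (X × X)
  edges z p p′ q q′ =
    (z , p) ∷ (z , p′) ∷ (p , p′) ∷ (z , q) ∷ (z , q′) ∷ (q , q′) ∷ (p , q) ∷ (p′ , q′) ∷ []
  block z p p′ q q′ = (p , q′) ∷ (p′ , q) ∷ edges z p p′ q q′ ++ edges z p p′ q q′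

  rung : X → (ℕ → X) → (ℕ → X) → ℕ → List (X × X)
  rung z p q k = block z (p k) (p (suc k)) (q k) (q (suc k))

  -- Three rungs, since three steps of 60° lead to the antipode.
  ladder : X → (ℕ → X) → (ℕ → X) → List (X × X)
  ladder z p q = rung z p q 0 ++ rung z p q 1 ++ rung z p q 2

  cycle : Fin 4 → Fin 4 → Fin 4
  cycle 0F 0F = 0F
  cycle 0F 1F = 2F
  cycle 0F 2F = 3F
  cycle 0F 3F = 1F
  cycle 1F 0F = 2F
  cycle 1F 1F = 1F
  cycle 1F 2F = 3F
  cycle 1F 3F = 0F
  cycle 2F 0F = 1F
  cycle 2F 1F = 3F
  cycle 2F 2F = 2F
  cycle 2F 3F = 0F
  cycle 3F 0F = 1F
  cycle 3F 1F = 2F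
  cycle 3F 2F = 0F
  cycle 3F 3F = 3F

  -- The two 3-cycles of the colours that fix o.
  turn : Fin 2 → Fin 4 → Fin 4 → Fin 4
  turn 0F o a = cycle o a
  turn 1F o a = cycle o (cycle o a)

  SameTurn : (o a b c e : Fin 4) → Set
  SameTurn o a b c e = ∃ λ s → b ≡ turn s o a × e ≡ turn s o c

  abstract
    -- Four colours leave a monochromatic pair in K₅. As the other eight edges count twice, a total
    -- of 1 means that just one diagonal is monochromatic, say a = e; then o, a, c, b are distinct,
    -- and the 3-cycle a ↦ b ↦ c ↦ a also takes c to e. All 4⁵ cases are evaluated.
    block-dichotomy : ∀ o a c b e → let n = monochromatic id (block o a c b e) in
                      1 ≤ n × (2 ≤ n ⊎ o ≢ c × SameTurn o a b c e)
    block-dichotomy = toWitness {a? = Fin.all? λ o → Fin.all? λ a → Fin.all? λ c → Fin.all? λ b → Fin.all? λ e →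
      let n = monochromatic id (block o a c b e) in
      1 ℕ.≤? n ×-dec
      (2 ℕ.≤? n ⊎-dec ¬? (o Fin.≟ c) ×-dec Fin.any? λ s → b Fin.≟ turn s o a ×-dec e Fin.≟ turn s o c)} _

    -- A 3-cycle and its inverse differ at every colour they move.
    turn-determines-sign : ∀ o c s s′ → turn s o c ≡ turn s′ o c → o ≢ c → s ≡ s′
    turn-determines-sign = toWitness {a? = Fin.all? λ o → Fin.all? λ c → Fin.all? λ s → Fin.all? λ s′ →
      (turn s o c Fin.≟ turn s′ o c) →-dec ¬? (o Fin.≟ c) →-dec s Fin.≟ s′} _

    -- With ρ = s₂⁻¹ s₁ s₃ in a cyclic group of order 3: a′ = ρ a and a = ρ a′ give
    -- ρ² a = a, hence ρ a = a.
    turns-close-up : ∀ o a a′ s₁ s₂ s₃ →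
                     turn s₃ o (turn s₁ o a) ≡ turn s₂ o a′ →
                     turn s₃ o (turn s₁ o a′) ≡ turn s₂ o a → a ≡ a′
    turns-close-up = toWitness {a? = Fin.all? λ o → Fin.all? λ a → Fin.all? λ a′ →
      Fin.all? λ s₁ → Fin.all? λ s₂ → Fin.all? λ s₃ →
      (turn s₃ o (turn s₁ o a) Fin.≟ turn s₂ o a′) →-dec
      (turn s₃ o (turn s₁ o a′) Fin.≟ turn s₂ o a) →-dec a Fin.≟ a′} _

  sameTurn-trans : ∀ {o a b c e f g} → o ≢ c →
                   SameTurn o a b c e → SameTurn o c e f g → SameTurn o a b f g
  sameTurn-trans {o} {c = c} o≢c (s , b≡ , e≡) (s′ , e≡′ , g≡)
    with ≡.refl ← turn-determines-sign o c s s′ (≡.trans (≡.sym e≡) e≡′) o≢c = s , b≡ , g≡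

  rung-dichotomy : ∀ (κ : X → Fin 4) z p q k → let n = monochromatic κ (rung z p q k) in
    1 ≤ n × (2 ≤ n ⊎ κ z ≢ κ (p (suc k)) ×
      SameTurn (κ z) (κ (p k)) (κ (q k)) (κ (p (suc k))) (κ (q (suc k))))
  rung-dichotomy κ z p q k = block-dichotomy (κ z) (κ (p k)) (κ (p (suc k))) (κ (q k)) (κ (q (suc k)))

  -- Consecutive rungs share the pair `p (suc k)`, `q (suc k)`, so without a surplus in any rung one
  -- 3-cycle persists along the ladder.
  ladder-dichotomy : ∀ (κ : X → Fin 4) z p q → let n = monochromatic κ (ladder z p q) in
    3 ≤ n × (4 ≤ n ⊎ SameTurn (κ z) (κ (p 0)) (κ (q 0)) (κ (p 3)) (κ (q 3)))
  ladder-dichotomy κ z p q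
    rewrite monochromatic-++ κ (rung z p q 0) (rung z p q 1 ++ rung z p q 2)
          | monochromatic-++ κ (rung z p q 1) (rung z p q 2)
    with rung-dichotomy κ z p q 0 | rung-dichotomy κ z p q 1 | rung-dichotomy κ z p q 2
  ... | l₀ , r₀ | l₁ , r₁ | l₂ , r₂ with r₀ | r₁ | r₂
  ... | inj₁ m₀ | _ | _ = ℕ.+-mono-≤ l₀ (ℕ.+-mono-≤ l₁ l₂) , inj₁ (ℕ.+-mono-≤ m₀ (ℕ.+-mono-≤ l₁ l₂))
  ... | inj₂ _ | inj₁ m₁ | _ = ℕ.+-mono-≤ l₀ (ℕ.+-mono-≤ l₁ l₂) , inj₁ (ℕ.+-mono-≤ l₀ (ℕ.+-mono-≤ m₁ l₂))
  ... | inj₂ _ | inj₂ _ | inj₁ m₂ = ℕ.+-mono-≤ l₀ (ℕ.+-mono-≤ l₁ l₂) , inj₁ (ℕ.+-mono-≤ l₀ (ℕ.+-mono-≤ l₁ m₂))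
  ... | inj₂ (≢₁ , t₀) | inj₂ (≢₂ , t₁) | inj₂ (_ , t₂) =
    ℕ.+-mono-≤ l₀ (ℕ.+-mono-≤ l₁ l₂) , inj₂ (sameTurn-trans ≢₁ t₀ (sameTurn-trans ≢₂ t₁ t₂))

  -- Meant for the orbits of `w`, `w′`, `w″`: the shift by 3 replaces `w″` by its antipode, and the
  -- leading pair is `w` with its antipode.
  obstruction : X → (ℕ → X) → (ℕ → X) → (ℕ → X) → List (X × X)
  obstruction z p q r =
    (p 0 , p 3) ∷ ladder z p q ++ ladder z p r ++ ladder z q (λ k → r (3 + k))

  private
    tally : ∀ {n₀ n₁ n₂ n₃} → 3 ≤ n₁ → 3 ≤ n₂ → 3 ≤ n₃ → 1 ≤ n₀ ⊎ 4 ≤ n₁ ⊎ 4 ≤ n₂ ⊎ 4 ≤ n₃ →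
            10 ≤ n₀ + (n₁ + (n₂ + n₃))
    tally l₁ l₂ l₃ (inj₁ m₀)               = ℕ.+-mono-≤ m₀ (ℕ.+-mono-≤ l₁ (ℕ.+-mono-≤ l₂ l₃))
    tally {n₀} l₁ l₂ l₃ (inj₂ (inj₁ m₁))        = ℕ.m≤n⇒m≤o+n n₀ (ℕ.+-mono-≤ m₁ (ℕ.+-mono-≤ l₂ l₃))
    tally {n₀} l₁ l₂ l₃ (inj₂ (inj₂ (inj₁ m₂))) = ℕ.m≤n⇒m≤o+n n₀ (ℕ.+-mono-≤ l₁ (ℕ.+-mono-≤ m₂ l₃))
    tally {n₀} l₁ l₂ l₃ (inj₂ (inj₂ (inj₂ m₃))) = ℕ.m≤n⇒m≤o+n n₀ (ℕ.+-mono-≤ l₁ (ℕ.+-mono-≤ l₂ m₃))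

  -- Each ladder contributes 3. The tenth pair is a surplus in some ladder or the pair `p 0`, `p 3`,
  -- because three ladders without surplus make the turns close up. The hypothesis on `r` expresses
  -- a full turn.
  obstruction-bound : ∀ (κ : X → Fin 4) z p q r → κ (r 6) ≡ κ (r 0) →
                      10 ≤ monochromatic κ (obstruction z p q r)
  obstruction-bound κ z p q r r₆≡r₀ =
    ≡.subst (10 ≤_) (≡.cong (n₀ +_) (≡.sym split))
      (tally {n₀} {n₁} {n₂} {n₃} (proj₁ d₁) (proj₁ d₂) (proj₁ d₃) (cases (proj₂ d₁) (proj₂ d₂) (proj₂ d₃)))
    where
    L₁ L₂ L₃ : List _
    L₁ = ladder z p q
    L₂ = ladder z p r
    L₃ = ladder z q (λ k → r (3 + k))
    n₀ n₁ n₂ n₃ : ℕ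
    n₀ = indicator (κ (p 0) Fin.≟ κ (p 3))
    n₁ = monochromatic κ L₁
    n₂ = monochromatic κ L₂
    n₃ = monochromatic κ L₃
    d₁ = ladder-dichotomy κ z p q
    d₂ = ladder-dichotomy κ z p r
    d₃ = ladder-dichotomy κ z q (λ k → r (3 + k))
    split : monochromatic κ (L₁ ++ (L₂ ++ L₃)) ≡ n₁ + (n₂ + n₃)
    split = ≡.trans (monochromatic-++ κ L₁ (L₂ ++ L₃)) (≡.cong (n₁ +_) (monochromatic-++ κ L₂ L₃))
    cases : 4 ≤ n₁ ⊎ SameTurn (κ z) (κ (p 0)) (κ (q 0)) (κ (p 3)) (κ (q 3)) →
            4 ≤ n₂ ⊎ SameTurn (κ z) (κ (p 0)) (κ (r 0)) (κ (p 3)) (κ (r 3)) →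
            4 ≤ n₃ ⊎ SameTurn (κ z) (κ (q 0)) (κ (r 3)) (κ (q 3)) (κ (r 6)) →
            1 ≤ n₀ ⊎ 4 ≤ n₁ ⊎ 4 ≤ n₂ ⊎ 4 ≤ n₃
    cases (inj₁ m₁) _         _         = inj₂ (inj₁ m₁)
    cases (inj₂ _)  (inj₁ m₂) _         = inj₂ (inj₂ (inj₁ m₂))
    cases (inj₂ _)  (inj₂ _)  (inj₁ m₃) = inj₂ (inj₂ (inj₂ m₃))
    cases (inj₂ (s₁ , q₀≡ , q₃≡)) (inj₂ (s₂ , r₀≡ , r₃≡)) (inj₂ (s₃ , r₃≡′ , r₆≡))
      with κ (p 0) Fin.≟ κ (p 3)
    ... | yes _     = inj₁ (s≤s z≤n)
    -- The two routes to `r 3`, from `p 3` directly and from `p 0` via `q 0`, give the first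
    -- relation; the routes to `r 6`, identified with `r 0`, give the second.
    ... | no  p₀≢p₃ = contradiction (turns-close-up (κ z) _ _ s₁ s₂ s₃
      (≡.trans (≡.cong (turn s₃ (κ z)) (≡.sym q₀≡)) (≡.trans (≡.sym r₃≡′) r₃≡))
      (≡.trans (≡.cong (turn s₃ (κ z)) (≡.sym q₃≡)) (≡.trans (≡.sym r₆≡) (≡.trans r₆≡r₀ r₀≡)))) p₀≢p₃

open PairCounting

-- Squared distances and direct isometries of the plane.

module Geometry (ℝ : CompleteOrderedField) where

  open Plane ℝ
  open IntegerSolver commutativeRing public
  open Setoid plane public using () renaming (_≈_ to _≈ₚ_; sym to ≈ₚ-sym; trans to ≈ₚ-trans)
  open import Relation.Binary.Reasoning.Setoid setoid

  -- Lets the solver reason modulo the relation a ≈ b.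
  modulo : ∀ {a b c x y} → a ≈ b → x ≈ y + (a - b) * c → x ≈ y
  modulo {a} {b} {c} {x} {y} a≈b x≈ = begin
    x               ≈⟨ x≈ ⟩
    y + (a - b) * c ≈⟨ +-congˡ (*-congʳ (+-congʳ a≈b)) ⟩
    y + (b - b) * c ≈⟨ solve 3 (λ y b c → y :+ (b :- b) :* c := y) refl y b c ⟩
    y               ∎

  sq : Point → Point → Carrier
  sq (x₁ , y₁) (x₂ , y₂) = (x₁ - x₂) * (x₁ - x₂) + (y₁ - y₂) * (y₁ - y₂)

  sq-nonNegative : ∀ A B → 0# ≤ sq A B
  sq-nonNegative A B = +-nonNegative (0≤x² _) (0≤x² _)

  dist² : ∀ A B → dist A B * dist A B ≈ sq A B
  dist² A B = √-square (sq-nonNegative A B)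

  sq≈0 : ∀ {A B} → sq A B ≈ 0# → A ≈ₚ B
  sq≈0 {x₁ , y₁} {x₂ , y₂} sq≈0 =
    equal (≤-respʳ-≈ sq≈0 (x≤x+y _ (0≤x² _))) ,
    equal (≤-respʳ-≈ (trans (+-comm _ _) sq≈0) (x≤x+y _ (0≤x² _)))
    where
    equal : ∀ {x y} → (x - y) * (x - y) ≤ 0# → x ≈ y
    equal {x} {y} le = begin
      x           ≈⟨ solve 2 (λ x y → x := (x :- y) :+ y) refl x y ⟩
      (x - y) + y ≈⟨ +-congʳ (x²≤0⇒x≈0 (x - y) le) ⟩
      0# + y      ≈⟨ +-identityˡ y ⟩
      y           ∎

  -- The direct isometry z ↦ u z + v of ℂ.
  motion : ∀ u₁ u₂ (v : Point) → u₁ * u₁ + u₂ * u₂ ≈ 1# → Isometry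
  motion u₁ u₂ (v₁ , v₂) unit = record
    { bijection = record
      { to        = to
      ; from      = from
      ; to-cong   = to-cong
      ; from-cong = from-cong
      ; inverse   = (λ {P} {Q} Q≈ → ≈ₚ-trans (to-cong Q≈) (to∘from P)) ,
                    (λ {P} {Q} Q≈ → ≈ₚ-trans (from-cong Q≈) (from∘to P))
      }
    ; isometric = λ { (x₁ , y₁) (x₂ , y₂) → √-cong (modulo unit (solve 8
        (λ u₁ u₂ v₁ v₂ x₁ y₁ x₂ y₂ →
          let X = (u₁ :* x₁ :- u₂ :* y₁ :+ v₁) :- (u₁ :* x₂ :- u₂ :* y₂ :+ v₁)
              Y = (u₂ :* x₁ :+ u₁ :* y₁ :+ v₂) :- (u₂ :* x₂ :+ u₁ :* y₂ :+ v₂)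
              S = (x₁ :- x₂) :* (x₁ :- x₂) :+ (y₁ :- y₂) :* (y₁ :- y₂)
          in X :* X :+ Y :* Y := S :+ (u₁ :* u₁ :+ u₂ :* u₂ :- num 1) :* S)
        refl u₁ u₂ v₁ v₂ x₁ y₁ x₂ y₂)) }
    }
    where
    to from : Point → Point
    to   (x , y) = u₁ * x - u₂ * y + v₁ , u₂ * x + u₁ * y + v₂
    from (x , y) = u₁ * (x - v₁) + u₂ * (y - v₂) , u₁ * (y - v₂) - u₂ * (x - v₁)
    to-cong : ∀ {P Q} → P ≈ₚ Q → to P ≈ₚ to Q
    to-cong (x≈ , y≈) =
      +-congʳ (+-cong (*-congˡ x≈) (-‿cong (*-congˡ y≈))) , +-congʳ (+-cong (*-congˡ x≈) (*-congˡ y≈))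
    from-cong : ∀ {P Q} → P ≈ₚ Q → from P ≈ₚ from Q
    from-cong (x≈ , y≈) =
      +-cong (*-congˡ (+-congʳ x≈)) (*-congˡ (+-congʳ y≈)) ,
      +-cong (*-congˡ (+-congʳ y≈)) (-‿cong (*-congˡ (+-congʳ x≈)))
    to∘from : ∀ P → to (from P) ≈ₚ P
    to∘from (x , y) =
      modulo unit (solve 6 (λ u₁ u₂ v₁ v₂ x y →
        u₁ :* (u₁ :* (x :- v₁) :+ u₂ :* (y :- v₂)) :- u₂ :* (u₁ :* (y :- v₂) :- u₂ :* (x :- v₁)) :+ v₁
        := x :+ (u₁ :* u₁ :+ u₂ :* u₂ :- num 1) :* (x :- v₁)) refl u₁ u₂ v₁ v₂ x y) ,
      modulo unit (solve 6 (λ u₁ u₂ v₁ v₂ x y →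
        u₂ :* (u₁ :* (x :- v₁) :+ u₂ :* (y :- v₂)) :+ u₁ :* (u₁ :* (y :- v₂) :- u₂ :* (x :- v₁)) :+ v₂
        := y :+ (u₁ :* u₁ :+ u₂ :* u₂ :- num 1) :* (y :- v₂)) refl u₁ u₂ v₁ v₂ x y)
    from∘to : ∀ P → from (to P) ≈ₚ P
    from∘to (x , y) =
      modulo unit (solve 6 (λ u₁ u₂ v₁ v₂ x y →
        u₁ :* (u₁ :* x :- u₂ :* y :+ v₁ :- v₁) :+ u₂ :* (u₂ :* x :+ u₁ :* y :+ v₂ :- v₂)
        := x :+ (u₁ :* u₁ :+ u₂ :* u₂ :- num 1) :* x) refl u₁ u₂ v₁ v₂ x y) ,
      modulo unit (solve 6 (λ u₁ u₂ v₁ v₂ x y →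
        u₁ :* (u₂ :* x :+ u₁ :* y :+ v₂ :- v₂) :- u₂ :* (u₁ :* x :- u₂ :* y :+ v₁ :- v₁)
        := y :+ (u₁ :* u₁ :+ u₂ :* u₂ :- num 1) :* y) refl u₁ u₂ v₁ v₂ x y)

  open Isometry using () renaming (to to _·_)

  transport : ∀ A B A′ B′ → sq A B ≈ sq A′ B′ → ¬ sq A B ≈ 0# →
              ∃ λ T → T · A ≈ₚ A′ × T · B ≈ₚ B′
  transport (a₁ , a₂) (b₁ , b₂) (a₁′ , a₂′) (b₁′ , b₂′) eq n≉0 =
    motion u₁ u₂ v unit , (image₁ , image₂) , (image₃ , image₄)
    where
    n n′ i x y x′ y′ u₁ u₂ : Carrier
    n  = sq (a₁ , a₂) (b₁ , b₂)
    n′ = sq (a₁′ , a₂′) (b₁′ , b₂′)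
    i  = n ⁻¹
    x  = a₁ - b₁
    y  = a₂ - b₂
    x′ = a₁′ - b₁′
    y′ = a₂′ - b₂′
    -- In ℂ, `u` is the quotient (A′ - B′)/(A - B), that is, A′ - B′ times the conjugate of A - B
    -- over `n`; then `v` is A′ - uA.
    u₁ = i * (x * x′ + y * y′)
    u₂ = i * (x * y′ - y * x′)
    v : Point
    v = a₁′ - (u₁ * a₁ - u₂ * a₂) , a₂′ - (u₂ * a₁ + u₁ * a₂)
    ni≈1 : n * i ≈ 1#
    ni≈1 = ⁻¹-inverseʳ n n≉0
    unit : u₁ * u₁ + u₂ * u₂ ≈ 1#
    unit = begin
      u₁ * u₁ + u₂ * u₂ ≈⟨ solve 5 (λ i x y x′ y′ →
        (i :* (x :* x′ :+ y :* y′)) :* (i :* (x :* x′ :+ y :* y′)) :+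
        (i :* (x :* y′ :- y :* x′)) :* (i :* (x :* y′ :- y :* x′))
        := ((x :* x :+ y :* y) :* i) :* ((x′ :* x′ :+ y′ :* y′) :* i)) refl i x y x′ y′ ⟩
      (n * i) * (n′ * i) ≈⟨ *-congˡ (*-congʳ eq) ⟨
      (n * i) * (n * i)  ≈⟨ *-cong ni≈1 ni≈1 ⟩
      1# * 1#            ≈⟨ *-identityˡ 1# ⟩
      1#                 ∎
    image₁ : u₁ * a₁ - u₂ * a₂ + proj₁ v ≈ a₁′
    image₁ = solve 2 (λ w a → w :+ (a :- w) := a) refl _ _
    image₂ : u₂ * a₁ + u₁ * a₂ + proj₂ v ≈ a₂′
    image₂ = solve 2 (λ w a → w :+ (a :- w) := a) refl _ _
    image₃ : u₁ * b₁ - u₂ * b₂ + proj₁ v ≈ b₁′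
    image₃ = modulo ni≈1 (solve 9 (λ i a₁ a₂ b₁ b₂ a₁′ a₂′ b₁′ b₂′ →
      let x = a₁ :- b₁ ; y = a₂ :- b₂ ; x′ = a₁′ :- b₁′ ; y′ = a₂′ :- b₂′
          u₁ = i :* (x :* x′ :+ y :* y′) ; u₂ = i :* (x :* y′ :- y :* x′)
      in u₁ :* b₁ :- u₂ :* b₂ :+ (a₁′ :- (u₁ :* a₁ :- u₂ :* a₂))
         := b₁′ :+ ((x :* x :+ y :* y) :* i :- num 1) :* (:- x′)) refl i a₁ a₂ b₁ b₂ a₁′ a₂′ b₁′ b₂′)
    image₄ : u₂ * b₁ + u₁ * b₂ + proj₂ v ≈ b₂′
    image₄ = modulo ni≈1 (solve 9 (λ i a₁ a₂ b₁ b₂ a₁′ a₂′ b₁′ b₂′ →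
      let x = a₁ :- b₁ ; y = a₂ :- b₂ ; x′ = a₁′ :- b₁′ ; y′ = a₂′ :- b₂′
          u₁ = i :* (x :* x′ :+ y :* y′) ; u₂ = i :* (x :* y′ :- y :* x′)
      in u₂ :* b₁ :+ u₁ :* b₂ :+ (a₂′ :- (u₂ :* a₁ :+ u₁ :* a₂))
         := b₂′ :+ ((x :* x :+ y :* y) :* i :- num 1) :* (:- y′)) refl i a₁ a₂ b₁ b₂ a₁′ a₂′ b₁′ b₂′)

-- Probabilities of agreement for the random colouring.

module RandomColouring (ℝ : CompleteOrderedField) (c₀ : Plane.ProperColouring ℝ 4)
  (P : Plane.LeftInvariantProbability ℝ (Plane.S₄×E₂ ℝ)) where

  open Plane ℝ
  open Geometry ℝ public
  open LeftInvariantProbability P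
  open ProperColouring c₀ using (colour-cong; proper)
  open Isometry using () renaming (to to _·_)
  private
    module Γ = Group S₄×E₂
    module D = Domination ℝ S₄×E₂ P
  open import Relation.Binary.Reasoning.Setoid setoid

  -- Colourings carry their congruence proof, because points such as `w″` and `orbit w″ 6` agree
  -- only up to `≈ₚ`.
  Colouring : Set
  Colouring = Func plane (≡.setoid (Fin 4))

  sample : Γ.Carrier → Colouring
  sample g@(σ , T) = record
    { to   = randomColouring c₀ g
    ; cong = λ A≈B → ≡.cong (Inverse.to σ) (colour-cong (Isometry.from-cong T A≈B))
    }

  π : Point → Point → Carrier
  π = monochromaticity c₀ P

  π-cong : ∀ {A A′ B B′} → A ≈ₚ A′ → B ≈ₚ B′ → π A B ≈ π A′ B′
  π-cong {A} {A′} {B} {B′} A≈ B≈ = μ-cong (sameColour c₀ A B) (sameColour c₀ A′ B′)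
    ( (λ {g} eq → ≡.trans (≡.sym (Func.cong (sample g) A≈)) (≡.trans eq (Func.cong (sample g) B≈)))
    , (λ {g} eq → ≡.trans (Func.cong (sample g) A≈) (≡.trans eq (≡.sym (Func.cong (sample g) B≈)))))

  π-refl : ∀ {A B} → A ≈ₚ B → π A B ≈ 1#
  π-refl {A} {B} A≈B = trans
    (μ-cong (sameColour c₀ A B) (everything S₄×E₂) ((λ _ → _) , (λ {g} _ → Func.cong (sample g) A≈B)))
    normalised

  -- The colour of TA under (σ, S) is the colour of A under (σ, T⁻¹S), so the two events differ by
  -- left translation by (id, T).
  π-motion : ∀ T A B → π (T · A) (T · B) ≈ π A B
  π-motion T A B = trans (μ-cong (sameColour c₀ (T · A) (T · B)) (leftTranslate t (sameColour c₀ A B))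
      ((λ {g} → ⊆ {g}) , (λ {g} → ⊇ {g})))
    (leftInvariant t (sameColour c₀ A B))
    where
    t : Γ.Carrier
    t = Identity.inverse _ , T
    ⊆ : ∀ {g} → holds (sameColour c₀ (T · A) (T · B)) g → holds (leftTranslate t (sameColour c₀ A B)) g
    ⊆ {g@(σ , S)} eq = (t Γ.⁻¹) Γ.∙ g , eq ,
      ((λ _ → ≡.refl) , λ X → ≈ₚ-sym (Isometry.strictlyInverseˡ T (S · X)))
    ⊇ : ∀ {g} → holds (leftTranslate t (sameColour c₀ A B)) g → holds (sameColour c₀ (T · A) (T · B)) g
    ⊇ {g} (e , eq , g≈te) = respects (sameColour c₀ (T · A) (T · B)) {t Γ.∙ e} {g} (Γ.sym {g} {t Γ.∙ e} g≈te)
      (≡.trans (Func.cong (sample e) (Isometry.strictlyInverseʳ T A))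
        (≡.trans eq (≡.sym (Func.cong (sample e) (Isometry.strictlyInverseʳ T B)))))

  π-congruent : ∀ A B A′ B′ → sq A B ≈ sq A′ B′ → π A B ≈ π A′ B′
  π-congruent A B A′ B′ eq = byCases (sq A B ≟ 0#)
    where
    moved : (∃ λ T → T · A ≈ₚ A′ × T · B ≈ₚ B′) → π A B ≈ π A′ B′
    moved (T , TA≈ , TB≈) = trans (sym (π-motion T A B)) (π-cong {T · A} {A′} {T · B} {B′} TA≈ TB≈)
    byCases : Dec (sq A B ≈ 0#) → π A B ≈ π A′ B′
    -- `transport` divides by the squared distance, so coincident points are treated apart: both
    -- probabilities are 1.
    byCases (yes ≈0) = trans (π-refl {A} {B} (sq≈0 {A} {B} ≈0))
      (sym (π-refl {A′} {B′} (sq≈0 {A′} {B′} (trans (sym eq) ≈0))))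
    byCases (no ≉0) = moved (transport A B A′ B′ eq ≉0)

  matching : Point × Point → D.DecEvent
  matching (A , B) = record
    { event  = sameColour c₀ A B
    ; holds? = λ g → randomColouring c₀ g A Fin.≟ randomColouring c₀ g B
    }

  π-unit : ∀ A B → dist A B ≈ 1# → π A B ≈ 0#
  π-unit A B AB≈1 = D.prob-empty (matching (A , B)) λ (σ , T) eq →
    proper (Isometry.from T A) (Isometry.from T B)
      (trans (Isometry.isometric (Group._⁻¹ E₂ T) A B) AB≈1)
      (≡.trans (≡.sym (Inverse.strictlyInverseʳ σ _))
        (≡.trans (≡.cong (Inverse.from σ) eq) (Inverse.strictlyInverseʳ σ _)))

  mean : List (Point × Point) → Carrier
  mean []            = 0#
  mean ((A , B) ∷ L) = π A B + mean L

  mean-++ : ∀ L L′ → mean (L ++ L′) ≈ mean L + mean L′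
  mean-++ []            L′ = sym (+-identityˡ _)
  mean-++ ((A , B) ∷ L) L′ = trans (+-congˡ (mean-++ L L′)) (sym (+-assoc _ _ _))

  -- Every sample is a colouring, so an inequality valid for all colourings passes to probabilities
  -- through `dominated`.
  mean-mono : ∀ L L′ →
    (∀ (κ : Colouring) → monochromatic (Func.to κ) L ℕ.≤ monochromatic (Func.to κ) L′) →
    mean L ≤ mean L′
  mean-mono L L′ le = ≡.subst₂ _≤_ (expected≡ L) (expected≡ L′)
    (D.dominated (List.map matching L) (List.map matching L′) λ g →
      ≡.subst₂ ℕ._≤_ (≡.sym (count≡ L g)) (≡.sym (count≡ L′ g)) (le (sample g)))
    where
    expected≡ : ∀ L → D.expected (List.map matching L) ≡ mean L
    expected≡ []            = ≡.refl
    expected≡ ((A , B) ∷ L) = ≡.cong (π A B +_) (expected≡ L)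
    count≡ : ∀ L g → D.count (List.map matching L) g ≡ monochromatic (Func.to (sample g)) L
    count≡ []            g = ≡.refl
    count≡ ((A , B) ∷ L) g = ≡.cong (indicator _ ℕ.+_) (count≡ L g)

-- The rotation by 60° and the lengths of the diagonals.

module Rotation (ℝ : CompleteOrderedField) where

  open Plane ℝ
  open Geometry ℝ
  open import Relation.Binary.Reasoning.Setoid setoid

  -- Reduces an inequality to a known one together with a ring identity for the solver.
  ≤-difference : ∀ {w x y z} → w ≤ x → x - w ≈ z - y → y ≤ z
  ≤-difference {w} {x} {y} {z} w≤x eq =
    ≤-respʳ-≈ (x+[y-x]≈y y z) (x≤x+y y (≤-respʳ-≈ eq (x≤y⇒0≤y-x w≤x)))

  1+1≉0 : ¬ 1# + 1# ≈ 0#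
  1+1≉0 eq = 1≰0 (≤-respʳ-≈ eq (x≤x+y 1# 0≤1))

  ½ : Carrier
  ½ = (1# + 1#) ⁻¹

  2½≈1 : (1# + 1#) * ½ ≈ 1#
  2½≈1 = ⁻¹-inverseʳ (1# + 1#) 1+1≉0

  abstract
    -- Abstract, so that it enters computations only through its sign and its square; `√3≡` links it
    -- to the root in the theorem.
    √3 : Carrier
    √3 = √ fromℕ 3

    √3≡ : √3 ≡ √ fromℕ 3
    √3≡ = ≡.refl

    √3-nonNegative : 0# ≤ √3
    √3-nonNegative = √-nonNegative _

    √3² : √3 * √3 ≈ 1# + 1# + 1#
    √3² = trans (√-square (+-nonNegative 0≤1 (+-nonNegative 0≤1 (+-nonNegative 0≤1 ≤-refl))))
      (solve 0 (nat 3 := num 3) refl)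

  ½√3 : Carrier
  ½√3 = ½ * √3

  ½√3-unit : ½ * ½ + ½√3 * ½√3 ≈ 1#
  ½√3-unit = begin
    ½ * ½ + ½√3 * ½√3
      ≈⟨ solve 2 (λ h r → h :* h :+ (h :* r) :* (h :* r) := (h :* h) :* (num 1 :+ r :* r)) refl ½ √3 ⟩
    (½ * ½) * (1# + √3 * √3)
      ≈⟨ *-congˡ (+-congˡ √3²) ⟩
    (½ * ½) * (1# + (1# + 1# + 1#))
      ≈⟨ solve 1 (λ h → (h :* h) :* (num 1 :+ (num 1 :+ num 1 :+ num 1))
                     := (num 2 :* h) :* (num 2 :* h)) refl ½ ⟩
    (1# + 1#) * ½ * ((1# + 1#) * ½)
      ≈⟨ *-cong 2½≈1 2½≈1 ⟩
    1# * 1#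
      ≈⟨ *-identityˡ 1# ⟩
    1# ∎

  rot : Point → Point
  rot (x , y) = ½ * x - ½√3 * y , ½√3 * x + ½ * y

  neg : Point → Point
  neg (x , y) = - x , - y

  O : Point
  O = 0# , 0#

  orbit : Point → ℕ → Point
  orbit p zero    = p
  orbit p (suc n) = rot (orbit p n)

  -- For ω = ½ + ½√3 i one has ω³ = -1. The cofactors given to the solver express this modulo h² +
  -- k² = 1 and 2h = 1.
  rot³ : ∀ p → orbit p 3 ≈ₚ neg p
  rot³ (x , y) =
    modulo ½√3-unit (modulo 2½≈1 (solve 4 (λ h k x y →
      let x₁ = h :* x :- k :* y ; y₁ = k :* x :+ h :* y
          x₂ = h :* x₁ :- k :* y₁ ; y₂ = k :* x₁ :+ h :* y₁
      in h :* x₂ :- k :* y₂ :=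
         (:- x :+ (h :* h :+ k :* k :- num 1) :* (k :* y :- num 3 :* h :* x))
         :+ (num 2 :* h :- num 1) :* ((num 2 :* h :- num 1) :* (h :+ num 1) :* x
                                     :- k :* (num 2 :* h :+ num 1) :* y))
      refl ½ ½√3 x y)) ,
    modulo ½√3-unit (modulo 2½≈1 (solve 4 (λ h k x y →
      let x₁ = h :* x :- k :* y ; y₁ = k :* x :+ h :* y
          x₂ = h :* x₁ :- k :* y₁ ; y₂ = k :* x₁ :+ h :* y₁
      in k :* x₂ :+ h :* y₂ :=
         (:- y :+ (h :* h :+ k :* k :- num 1) :* (:- (k :* x) :- num 3 :* h :* y))
         :+ (num 2 :* h :- num 1) :* ((num 2 :* h :- num 1) :* (h :+ num 1) :* y
                                     :+ k :* (num 2 :* h :+ num 1) :* x))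
      refl ½ ½√3 x y))

  rot-cong : ∀ {p q} → p ≈ₚ q → rot p ≈ₚ rot q
  rot-cong (x≈ , y≈) =
    +-cong (*-congˡ x≈) (-‿cong (*-congˡ y≈)) , +-cong (*-congˡ x≈) (*-congˡ y≈)

  sq-cong : ∀ {A A′ B B′} → A ≈ₚ A′ → B ≈ₚ B′ → sq A B ≈ sq A′ B′
  sq-cong (x₁≈ , y₁≈) (x₂≈ , y₂≈) = +-cong (*-cong Δx Δx) (*-cong Δy Δy)
    where
    Δx = +-cong x₁≈ (-‿cong x₂≈)
    Δy = +-cong y₁≈ (-‿cong y₂≈)

  sq-rot : ∀ p q → sq (rot p) (rot q) ≈ sq p q
  sq-rot (x₁ , y₁) (x₂ , y₂) = modulo ½√3-unit (solve 6 (λ h k x₁ y₁ x₂ y₂ →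
    let X = (h :* x₁ :- k :* y₁) :- (h :* x₂ :- k :* y₂)
        Y = (k :* x₁ :+ h :* y₁) :- (k :* x₂ :+ h :* y₂)
        S = (x₁ :- x₂) :* (x₁ :- x₂) :+ (y₁ :- y₂) :* (y₁ :- y₂)
    in X :* X :+ Y :* Y := S :+ (h :* h :+ k :* k :- num 1) :* S) refl ½ ½√3 x₁ y₁ x₂ y₂)

  sq-O-rot : ∀ p → sq O (rot p) ≈ sq O p
  sq-O-rot (x , y) = modulo ½√3-unit (solve 4 (λ h k x y →
    let X = num 0 :- (h :* x :- k :* y)
        Y = num 0 :- (k :* x :+ h :* y)
        S = (num 0 :- x) :* (num 0 :- x) :+ (num 0 :- y) :* (num 0 :- y)
    in X :* X :+ Y :* Y := S :+ (h :* h :+ k :* k :- num 1) :* S) refl ½ ½√3 x y)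

  -- `O`, `p` and `rot p` form an equilateral triangle.
  sq-self-rot : ∀ p → sq p (rot p) ≈ sq O p
  sq-self-rot (x , y) = modulo ½√3-unit (modulo 2½≈1 (solve 4 (λ h k x y →
    let X = x :- (h :* x :- k :* y)
        Y = y :- (k :* x :+ h :* y)
        S = (num 0 :- x) :* (num 0 :- x) :+ (num 0 :- y) :* (num 0 :- y)
    in X :* X :+ Y :* Y := S :+ (h :* h :+ k :* k :- num 1) :* S :+ (num 2 :* h :- num 1) :* (:- S))
    refl ½ ½√3 x y))

  -- ∣p∣² + ∣q∣² − p·q, the mean of the squared lengths of the two diagonals.
  diagonal² cross : Point → Point → Carrier
  diagonal² (x₁ , y₁) (x₂ , y₂) = x₁ * x₁ + y₁ * y₁ + (x₂ * x₂ + y₂ * y₂) - (x₁ * x₂ + y₁ * y₂)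
  cross     (x₁ , y₁) (x₂ , y₂) = x₁ * y₂ - y₁ * x₂

  -- Law of cosines with 2 p·ρq = p·q - √3 `cross p q`. For the other diagonal the cross product
  -- changes sign.
  sq-diagonal₁ : ∀ p q → sq p (rot q) ≈ diagonal² p q + √3 * cross p q
  sq-diagonal₁ (x₁ , y₁) (x₂ , y₂) = modulo ½√3-unit (modulo 2½≈1 (solve 6 (λ h r x₁ y₁ x₂ y₂ →
    let k = h :* r
        X = x₁ :- (h :* x₂ :- k :* y₂)
        Y = y₁ :- (k :* x₂ :+ h :* y₂)
        D = x₁ :* x₁ :+ y₁ :* y₁ :+ (x₂ :* x₂ :+ y₂ :* y₂) :- (x₁ :* x₂ :+ y₁ :* y₂)
        C = x₁ :* y₂ :- y₁ :* x₂
    in X :* X :+ Y :* Y := D :+ r :* C :+ (h :* h :+ k :* k :- num 1) :* (x₂ :* x₂ :+ y₂ :* y₂)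
                           :+ (num 2 :* h :- num 1) :* (r :* C :- (x₁ :* x₂ :+ y₁ :* y₂)))
    refl ½ √3 x₁ y₁ x₂ y₂))

  sq-diagonal₂ : ∀ p q → sq (rot p) q ≈ diagonal² p q - √3 * cross p q
  sq-diagonal₂ (x₁ , y₁) (x₂ , y₂) = modulo ½√3-unit (modulo 2½≈1 (solve 6 (λ h r x₁ y₁ x₂ y₂ →
    let k = h :* r
        X = (h :* x₁ :- k :* y₁) :- x₂
        Y = (k :* x₁ :+ h :* y₁) :- y₂
        D = x₁ :* x₁ :+ y₁ :* y₁ :+ (x₂ :* x₂ :+ y₂ :* y₂) :- (x₁ :* x₂ :+ y₁ :* y₂)
        C = x₁ :* y₂ :- y₁ :* x₂
    in X :* X :+ Y :* Y := D :- r :* C :+ (h :* h :+ k :* k :- num 1) :* (x₁ :* x₁ :+ y₁ :* y₁)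
                           :+ (num 2 :* h :- num 1) :* (:- (r :* C) :- (x₁ :* x₂ :+ y₁ :* y₂)))
    refl ½ √3 x₁ y₁ x₂ y₂))

-- The spindle bound and expected counts of blocks and ladders.

module Bounds (ℝ : CompleteOrderedField) (c₀ : Plane.ProperColouring ℝ 4)
  (P : Plane.LeftInvariantProbability ℝ (Plane.S₄×E₂ ℝ)) where

  open Plane ℝ
  open RandomColouring ℝ c₀ P
  open Rotation ℝ
  open import Relation.Binary.Reasoning.Setoid setoid

  mean-replicate : ∀ n → mean (replicate n (O , O)) ≈ fromℕ n
  mean-replicate zero    = refl
  mean-replicate (suc n) = +-cong (π-refl {O} {O} (refl , refl)) (mean-replicate n)

  -- The pair (`O`, `O`) is always monochromatic, so `n` copies of it play the constant n in
  -- `mean-mono`.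
  mean-lowerBound : ∀ n L → (∀ (κ : Colouring) → n ℕ.≤ monochromatic (Func.to κ) L) → fromℕ n ≤ mean L
  mean-lowerBound n L le = ≤-respˡ-≈ (mean-replicate n)
    (mean-mono (replicate n (O , O)) L λ κ → ℕ.≤-trans (few (Func.to κ) n) (le κ))
    where
    few : ∀ (κ : Point → Fin 4) n → monochromatic κ (replicate n (O , O)) ℕ.≤ n
    few κ zero    = z≤n
    few κ (suc n) = ℕ.+-mono-≤ (indicator-≤1 (κ O Fin.≟ κ O)) (few κ n)

  Bounded : Carrier → Carrier → Set
  Bounded γ ℓ² = ∀ A B → sq A B ≈ ℓ² → π A B ≤ γ

  bounded-cong : ∀ {γ x y} → x ≈ y → Bounded γ x → Bounded γ y
  bounded-cong x≈y b A B eq = b A B (trans eq (sym x≈y))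

  module _ (σ α : Carrier) (base : Bounded α ((σ + σ) * (σ + σ))) where

    -- Here σ is half the base. The hypothesis makes the height `x` real, so `O`, (x, σ), (x, -σ) is
    -- isosceles with legs of the length of AB; in the second list (`O`, `O`) stands for the
    -- constant 1.
    spindle : ∀ A B → σ * σ ≤ sq A B → π A B + π A B ≤ 1# + α
    spindle A B σ²≤ =
      ≤-respˡ-≈ (+-cong (π-congruent O X A B OX) (trans (+-identityʳ _) (π-congruent O Y A B OY)))
        (≤-trans
          (mean-mono ((O , X) ∷ (O , Y) ∷ []) ((O , O) ∷ (X , Y) ∷ []) λ κ → pointwise (Func.to κ))
          (+-mono-≤ (≤-reflexive (π-refl {O} {O} (refl , refl)))
            (≤-respˡ-≈ (sym (+-identityʳ _)) (base X Y XY))))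
      where
      x : Carrier
      x = √ (sq A B - σ * σ)
      x² : x * x ≈ sq A B - σ * σ
      x² = √-square (x≤y⇒0≤y-x σ²≤)
      X Y : Point
      X = x , σ
      Y = x , - σ
      OX : sq O X ≈ sq A B
      OX = begin
        sq O X                  ≈⟨ solve 2 (λ x s → (num 0 :- x) :* (num 0 :- x) :+ (num 0 :- s) :* (num 0 :- s)
                                     := s :* s :+ x :* x) refl x σ ⟩
        σ * σ + x * x           ≈⟨ +-congˡ x² ⟩
        σ * σ + (sq A B - σ * σ) ≈⟨ x+[y-x]≈y _ _ ⟩
        sq A B                  ∎
      OY : sq O Y ≈ sq A B
      OY = trans (solve 2 (λ x s → (num 0 :- x) :* (num 0 :- x) :+ (num 0 :- (:- s)) :* (num 0 :- (:- s))
        := (num 0 :- x) :* (num 0 :- x) :+ (num 0 :- s) :* (num 0 :- s)) refl x σ) OX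
      XY : sq X Y ≈ (σ + σ) * (σ + σ)
      XY = solve 2 (λ x s → (x :- x) :* (x :- x) :+ (s :- (:- s)) :* (s :- (:- s)) := (s :+ s) :* (s :+ s)) refl x σ
      pointwise : ∀ (κ : Point → Fin 4) →
        monochromatic κ ((O , X) ∷ (O , Y) ∷ []) ℕ.≤ monochromatic κ ((O , O) ∷ (X , Y) ∷ [])
      pointwise κ with κ O Fin.≟ κ O | κ O Fin.≟ κ X | κ O Fin.≟ κ Y | κ X Fin.≟ κ Y
      ... | no o≢o | _     | _     | _      = contradiction ≡.refl o≢o
      ... | yes _  | yes p | yes q | no x≢y = contradiction (≡.trans (≡.sym p) q) x≢y
      ... | yes _  | yes _ | yes _ | yes _  = ℕ.≤-refl
      ... | yes _  | yes _ | no _  | _      = s≤s z≤n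
      ... | yes _  | no _  | yes _ | _      = s≤s z≤n
      ... | yes _  | no _  | no _  | _      = z≤n

    -- Data for the K₅ on `O`, `p`, `rot p`, `q`, `rot q`: its edges other than the diagonals have
    -- lengths |p|, |q| and |p - q| only, and the diagonals are long enough for `spindle`.
    record Quad (p q : Point) (γ₁ γ₂ γ₃ : Carrier) : Set where
      field
        side₁     : Bounded γ₁ (sq O p)
        side₂     : Bounded γ₂ (sq O q)
        side₃     : Bounded γ₃ (sq p q)
        diagonal₁ : σ * σ ≤ sq p (rot q)
        diagonal₂ : σ * σ ≤ sq (rot p) q

    open Quad

    rotate : ∀ {p q γ₁ γ₂ γ₃} → Quad p q γ₁ γ₂ γ₃ → Quad (rot p) (rot q) γ₁ γ₂ γ₃
    rotate {p} {q} Q = record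
      { side₁     = bounded-cong (sym (sq-O-rot p)) (side₁ Q)
      ; side₂     = bounded-cong (sym (sq-O-rot q)) (side₂ Q)
      ; side₃     = bounded-cong (sym (sq-rot p q)) (side₃ Q)
      ; diagonal₁ = ≤-respʳ-≈ (sym (sq-rot p (rot q))) (diagonal₁ Q)
      ; diagonal₂ = ≤-respʳ-≈ (sym (sq-rot (rot p) q)) (diagonal₂ Q)
      }

    edgeBound blockBound : (γ₁ γ₂ γ₃ : Carrier) → Carrier
    edgeBound γ₁ γ₂ γ₃ = γ₁ + (γ₁ + (γ₁ + (γ₂ + (γ₂ + (γ₂ + (γ₃ + (γ₃ + 0#)))))))
    blockBound γ₁ γ₂ γ₃ = (1# + α) + (1# + α) + ((e + e) + (e + e))
      where e = edgeBound γ₁ γ₂ γ₃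

    -- `spindle` bounds twice a probability, so means are doubled throughout. Each diagonal
    -- contributes 1 + α; the other edges occur twice in the block, hence four times here.
    block-mean : ∀ {p q γ₁ γ₂ γ₃} → Quad p q γ₁ γ₂ γ₃ →
                 let x = mean (block O p (rot p) q (rot q)) in x + x ≤ blockBound γ₁ γ₂ γ₃
    block-mean {p} {q} {γ₁} {γ₂} {γ₃} Q = ≤-respˡ-≈ (sym regroup)
      (+-mono-≤ (+-mono-≤ (spindle p (rot q) (diagonal₁ Q)) (spindle (rot p) q (diagonal₂ Q)))
        (+-mono-≤ (+-mono-≤ edges≤ edges≤) (+-mono-≤ edges≤ edges≤)))
      where
      E : List (Point × Point)
      E = edges O p (rot p) q (rot q)
      x₁ x₂ e : Carrier
      x₁ = π p (rot q)
      x₂ = π (rot p) q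
      e  = mean E
      regroup : let x = mean (block O p (rot p) q (rot q)) in
        x + x ≈ (x₁ + x₁) + (x₂ + x₂) + ((e + e) + (e + e))
      regroup = trans (+-cong eq eq) (solve 3 (λ x₁ x₂ e →
        (x₁ :+ (x₂ :+ (e :+ e))) :+ (x₁ :+ (x₂ :+ (e :+ e)))
        := (x₁ :+ x₁) :+ (x₂ :+ x₂) :+ ((e :+ e) :+ (e :+ e)))
        refl x₁ x₂ e)
        where
        eq : mean (block O p (rot p) q (rot q)) ≈ x₁ + (x₂ + (e + e))
        eq = +-congˡ (+-congˡ (mean-++ E E))
      edges≤ : e ≤ edgeBound γ₁ γ₂ γ₃
      edges≤ =
        +-mono-≤ (side₁ Q O p refl) (+-mono-≤ (side₁ Q O (rot p) (sq-O-rot p))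
        (+-mono-≤ (side₁ Q p (rot p) (sq-self-rot p))
        (+-mono-≤ (side₂ Q O q refl) (+-mono-≤ (side₂ Q O (rot q) (sq-O-rot q))
        (+-mono-≤ (side₂ Q q (rot q) (sq-self-rot q))
        (+-mono-≤ (side₃ Q p q refl) (+-mono-≤ (side₃ Q (rot p) (rot q) (sq-rot p q)) ≤-refl)))))))

    ladder-mean : ∀ {p q γ₁ γ₂ γ₃} → Quad p q γ₁ γ₂ γ₃ →
                  let x = mean (ladder O (orbit p) (orbit q)) ; b = blockBound γ₁ γ₂ γ₃ in
                  x + x ≤ b + (b + b)
    ladder-mean {p} {q} {γ₁} {γ₂} {γ₃} Q = ≤-respˡ-≈ (sym regroup)
      (+-mono-≤ (block-mean Q) (+-mono-≤ (block-mean (rotate Q)) (block-mean (rotate (rotate Q)))))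
      where
      R : ℕ → List (Point × Point)
      R = rung O (orbit p) (orbit q)
      regroup : let x = mean (R 0 ++ (R 1 ++ R 2)) in
        x + x ≈ (mean (R 0) + mean (R 0)) + ((mean (R 1) + mean (R 1)) + (mean (R 2) + mean (R 2)))
      regroup = trans (+-cong eq eq) (solve 3 (λ a b c →
        (a :+ (b :+ c)) :+ (a :+ (b :+ c)) := (a :+ a) :+ ((b :+ b) :+ (c :+ c)))
        refl (mean (R 0)) (mean (R 1)) (mean (R 2)))
        where
        eq : mean (R 0 ++ (R 1 ++ R 2)) ≈ mean (R 0) + (mean (R 1) + mean (R 2))
        eq = trans (mean-++ (R 0) (R 1 ++ R 2)) (+-congˡ (mean-++ (R 1) (R 2)))

-- The configuration w, w′, w″ and its weighted inequality.

module TwoDistances (ℝ : CompleteOrderedField) (c₀ : Plane.ProperColouring ℝ 4)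
  (P : Plane.LeftInvariantProbability ℝ (Plane.S₄×E₂ ℝ)) where

  open Plane ℝ
  open RandomColouring ℝ c₀ P
  open Rotation ℝ
  open Bounds ℝ c₀ P
  open import Relation.Binary.Reasoning.Setoid setoid

  module _ (σ τ H α β : Carrier)
           (H²+τ²≈4σ² : H * H + τ * τ ≈ (σ + σ) * (σ + σ))
           (0≤Hτ : 0# ≤ H * τ)
           (diagonal-long : σ * σ + √3 * (H * τ + H * τ) ≤ H * H + (τ * τ + τ * τ + τ * τ))
           (boundα : Bounded α ((σ + σ) * (σ + σ)))
           (boundβ : Bounded β ((τ + τ) * (τ + τ))) where

    quad-cong : ∀ {p q q′ γ₁ γ₂ γ₃} → q ≈ₚ q′ → Quad σ α boundα p q γ₁ γ₂ γ₃ →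
                Quad σ α boundα p q′ γ₁ γ₂ γ₃
    quad-cong {p} {q} {q′} q≈q′ Q = record
      { side₁     = side₁
      ; side₂     = bounded-cong (sq-cong {O} {O} {q} {q′} (refl , refl) q≈q′) side₂
      ; side₃     = bounded-cong (sq-cong {p} {p} {q} {q′} (refl , refl) q≈q′) side₃
      ; diagonal₁ = ≤-respʳ-≈ (sq-cong {p} {p} {rot q} {rot q′} (refl , refl) (rot-cong {q} {q′} q≈q′)) diagonal₁
      ; diagonal₂ = ≤-respʳ-≈ (sq-cong {rot p} {rot p} {q} {q′} (refl , refl) q≈q′) diagonal₂
      }
      where open Quad Q

    private
      -- The three pairs of vectors span congruent triangles with the origin, of sides 2σ, 2σ, 2τ.
      -- So `diagonal²`, half the sum of the squared sides, is always `M`, and `cross`, twice the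
      -- signed area, is ±c.
      M c : Carrier
      M = H * H + (τ * τ + τ * τ + τ * τ)
      c = H * τ + H * τ

    -- The squared diagonals are M ± √3 c. The sign of `cross` decides which is the shorter, and
    -- `diagonal-long` bounds that one.
    diagonals-long : ∀ p q → diagonal² p q ≈ M → cross p q ≈ c ⊎ cross p q ≈ - c →
                     σ * σ ≤ sq p (rot q) × σ * σ ≤ sq (rot p) q
    diagonals-long p q D≈M C≈±c = signs C≈±c
      where
      minus : σ * σ ≤ M - √3 * c
      minus = ≤-difference diagonal-long
        (solve 3 (λ s x m → m :- (s :+ x) := (m :- x) :- s) refl (σ * σ) (√3 * c) M)
      plus : σ * σ ≤ M + √3 * c
      plus = ≤-trans minus (≤-difference
        (let 0≤x = *-nonNegative √3-nonNegative (+-nonNegative 0≤Hτ 0≤Hτ) in +-nonNegative 0≤x 0≤x)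
        (solve 2 (λ m x → (x :+ x) :- num 0 := (m :+ x) :- (m :- x)) refl M (√3 * c)))
      value₁ : ∀ {y} → cross p q ≈ y → sq p (rot q) ≈ M + √3 * y
      value₁ C≈ = trans (sq-diagonal₁ p q) (+-cong D≈M (*-congˡ C≈))
      value₂ : ∀ {y} → cross p q ≈ y → sq (rot p) q ≈ M - √3 * y
      value₂ C≈ = trans (sq-diagonal₂ p q) (+-cong D≈M (-‿cong (*-congˡ C≈)))
      neg₁ : M + √3 * - c ≈ M - √3 * c
      neg₁ = solve 3 (λ m r c → m :+ r :* (:- c) := m :- r :* c) refl M √3 c
      neg₂ : M - √3 * - c ≈ M + √3 * c
      neg₂ = solve 3 (λ m r c → m :- r :* (:- c) := m :+ r :* c) refl M √3 c
      signs : cross p q ≈ c ⊎ cross p q ≈ - c → σ * σ ≤ sq p (rot q) × σ * σ ≤ sq (rot p) q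
      signs (inj₁ C≈) = ≤-respʳ-≈ (sym (value₁ C≈)) plus , ≤-respʳ-≈ (sym (value₂ C≈)) minus
      signs (inj₂ C≈) = ≤-respʳ-≈ (sym (trans (value₁ C≈) neg₁)) minus ,
                        ≤-respʳ-≈ (sym (trans (value₂ C≈) neg₂)) plus

    -- With s = 2σ and t = 2τ, the triangle O, w, w′ is isosceles with legs s, base t and height H,
    -- and `w″` is w - w′.
    w w′ w″ : Point
    w  = H , τ
    w′ = H , - τ
    w″ = 0# , τ + τ

    quad₁ : Quad σ α boundα w w′ α α β
    quad₁ = record
      { side₁     = bounded-cong (sym (trans (solve 2 (λ H t →
          (num 0 :- H) :* (num 0 :- H) :+ (num 0 :- t) :* (num 0 :- t) := H :* H :+ t :* t)
          refl H τ) H²+τ²≈4σ²)) boundα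
      ; side₂     = bounded-cong (sym (trans (solve 2 (λ H t →
          (num 0 :- H) :* (num 0 :- H) :+ (num 0 :- (:- t)) :* (num 0 :- (:- t)) := H :* H :+ t :* t)
          refl H τ) H²+τ²≈4σ²)) boundα
      ; side₃     = bounded-cong (sym (solve 2 (λ H t →
          (H :- H) :* (H :- H) :+ (t :- (:- t)) :* (t :- (:- t)) := (t :+ t) :* (t :+ t)) refl H τ)) boundβ
      ; diagonal₁ = proj₁ long
      ; diagonal₂ = proj₂ long
      }
      where
      long = diagonals-long w w′
        (solve 2 (λ H t → H :* H :+ t :* t :+ (H :* H :+ (:- t) :* (:- t)) :- (H :* H :+ t :* (:- t))
          := H :* H :+ (t :* t :+ t :* t :+ t :* t)) refl H τ)
        (inj₂ (solve 2 (λ H t → H :* (:- t) :- t :* H := :- (H :* t :+ H :* t)) refl H τ))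

    quad₂ : Quad σ α boundα w w″ α β α
    quad₂ = record
      { side₁     = Quad.side₁ quad₁
      ; side₂     = bounded-cong (sym (solve 1 (λ t →
          (num 0 :- num 0) :* (num 0 :- num 0) :+ (num 0 :- (t :+ t)) :* (num 0 :- (t :+ t)) := (t :+ t) :* (t :+ t))
          refl τ)) boundβ
      ; side₃     = bounded-cong (sym (trans (solve 2 (λ H t →
          (H :- num 0) :* (H :- num 0) :+ (t :- (t :+ t)) :* (t :- (t :+ t)) := H :* H :+ t :* t)
          refl H τ) H²+τ²≈4σ²)) boundα
      ; diagonal₁ = proj₁ long
      ; diagonal₂ = proj₂ long
      }
      where
      long = diagonals-long w w″
        (solve 2 (λ H t → H :* H :+ t :* t :+ (num 0 :* num 0 :+ (t :+ t) :* (t :+ t)) :- (H :* num 0 :+ t :* (t :+ t))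
          := H :* H :+ (t :* t :+ t :* t :+ t :* t)) refl H τ)
        (inj₁ (solve 2 (λ H t → H :* (t :+ t) :- t :* num 0 := H :* t :+ H :* t) refl H τ))

    -- The difference of `w′` and the antipode of `w″` is `w`, whence the bounds α, β, α.
    quad₃ : Quad σ α boundα w′ (orbit w″ 3) α β α
    quad₃ = quad-cong {w′} {neg w″} {orbit w″ 3} (≈ₚ-sym (rot³ w″)) record
      { side₁     = Quad.side₂ quad₁
      ; side₂     = bounded-cong (sym (solve 1 (λ t →
          (num 0 :- (:- num 0)) :* (num 0 :- (:- num 0)) :+ (num 0 :- (:- (t :+ t))) :* (num 0 :- (:- (t :+ t))) := (t :+ t) :* (t :+ t))
          refl τ)) boundβ
      ; side₃     = bounded-cong (sym (trans (solve 2 (λ H t →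
          (H :- (:- num 0)) :* (H :- (:- num 0)) :+ ((:- t) :- (:- (t :+ t))) :* ((:- t) :- (:- (t :+ t))) := H :* H :+ t :* t)
          refl H τ) H²+τ²≈4σ²)) boundα
      ; diagonal₁ = proj₁ long
      ; diagonal₂ = proj₂ long
      }
      where
      long = diagonals-long w′ (neg w″)
        (solve 2 (λ H t → H :* H :+ (:- t) :* (:- t) :+ ((:- num 0) :* (:- num 0) :+ (:- (t :+ t)) :* (:- (t :+ t)))
            :- (H :* (:- num 0) :+ (:- t) :* (:- (t :+ t)))
          := H :* H :+ (t :* t :+ t :* t :+ t :* t)) refl H τ)
        (inj₂ (solve 2 (λ H t → H :* (:- (t :+ t)) :- (:- t) :* (:- num 0) := :- (H :* t :+ H :* t)) refl H τ))

    antipodal-long : σ * σ ≤ sq w (orbit w 3)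
    antipodal-long = ≤-respʳ-≈ (sym (sq-cong {w} {w} {orbit w 3} {neg w} (refl , refl) (rot³ w)))
      -- The squares of 3σ, 2σ, σ, σ add up to 15σ², the excess of |2w|² = 16σ² over σ².
      (≤-respʳ-≈ eq (x≤x+y (σ * σ) (+-nonNegative (0≤x² ((σ + σ) + σ))
        (+-nonNegative (0≤x² (σ + σ)) (+-nonNegative (0≤x² σ) (0≤x² σ))))))
      where
      eq : σ * σ + (((σ + σ) + σ) * ((σ + σ) + σ) + ((σ + σ) * (σ + σ) + (σ * σ + σ * σ))) ≈ sq w (neg w)
      eq = begin
        _ ≈⟨ solve 1 (λ s → s :* s :+ (((s :+ s) :+ s) :* ((s :+ s) :+ s) :+ ((s :+ s) :* (s :+ s) :+ (s :* s :+ s :* s)))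
               := num 4 :* ((s :+ s) :* (s :+ s))) refl σ ⟩
        (1# + 1# + 1# + 1#) * ((σ + σ) * (σ + σ)) ≈⟨ *-congˡ H²+τ²≈4σ² ⟨
        (1# + 1# + 1# + 1#) * (H * H + τ * τ)     ≈⟨ solve 2 (λ H t → num 4 :* (H :* H :+ t :* t)
               := (H :- (:- H)) :* (H :- (:- H)) :+ (t :- (:- t)) :* (t :- (:- t))) refl H τ ⟩
        sq w (neg w) ∎

    private
      L₁ L₂ L₃ : List (Point × Point)
      L₁ = ladder O (orbit w) (orbit w′)
      L₂ = ladder O (orbit w) (orbit w″)
      L₃ = ladder O (orbit w′) (λ k → orbit w″ (3 ℕ.+ k))

    10≤mean : fromℕ 10 ≤ π w (orbit w 3) + (mean L₁ + (mean L₂ + mean L₃))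
    10≤mean = ≤-respʳ-≈ (+-congˡ (trans (mean-++ L₁ (L₂ ++ L₃)) (+-congˡ (mean-++ L₂ L₃))))
      (mean-lowerBound 10 (obstruction O (orbit w) (orbit w′) (orbit w″)) λ κ →
        obstruction-bound (Func.to κ) O (orbit w) (orbit w′) (orbit w″) (Func.cong κ full-turn))
      where
      full-turn : orbit w″ 6 ≈ₚ w″
      full-turn = ≈ₚ-trans (rot³ (orbit w″ 3))
        (≈ₚ-trans (-‿cong (proj₁ (rot³ w″)) , -‿cong (proj₂ (rot³ w″)))
          (solve 1 (λ x → :- (:- x) := x) refl 0# , solve 1 (λ x → :- (:- x) := x) refl (τ + τ)))

    -- After doubling, 20 is at most 1 + α for the antipodal pair, plus 3(2 + 26α + 8β) for the
    -- first ladder, plus twice 3(2 + 22α + 12β) for the others: in total 19 + 211α + 96β.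
    weighted-bound : 1# ≤ fromℕ 211 * α + fromℕ 96 * β
    weighted-bound = ≤-difference (≤-trans (+-mono-≤ 10≤mean 10≤mean) (≤-respˡ-≈ (sym regroup)
      (+-mono-≤ (spindle σ α boundα w (orbit w 3) antipodal-long)
        (+-mono-≤ (ladder-mean σ α boundα quad₁)
          (+-mono-≤ (ladder-mean σ α boundα quad₂) (ladder-mean σ α boundα quad₃))))))
      (solve 2 (λ a b →
        let e₁ = a :+ (a :+ (a :+ (a :+ (a :+ (a :+ (b :+ (b :+ num 0)))))))
            e₂ = a :+ (a :+ (a :+ (b :+ (b :+ (b :+ (a :+ (a :+ num 0)))))))
            b₁ = (num 1 :+ a) :+ (num 1 :+ a) :+ ((e₁ :+ e₁) :+ (e₁ :+ e₁))
            b₂ = (num 1 :+ a) :+ (num 1 :+ a) :+ ((e₂ :+ e₂) :+ (e₂ :+ e₂))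
            l₁ = b₁ :+ (b₁ :+ b₁)
            l₂ = b₂ :+ (b₂ :+ b₂)
        in ((num 1 :+ a) :+ (l₁ :+ (l₂ :+ l₂))) :- (nat 10 :+ nat 10)
           := (nat 211 :* a :+ nat 96 :* b) :- num 1) refl α β)
      where
      regroup : let x = π w (orbit w 3) + (mean L₁ + (mean L₂ + mean L₃)) in
        x + x ≈ (π w (orbit w 3) + π w (orbit w 3)) +
                ((mean L₁ + mean L₁) + ((mean L₂ + mean L₂) + (mean L₃ + mean L₃)))
      regroup = solve 4 (λ x a b c → (x :+ (a :+ (b :+ c))) :+ (x :+ (a :+ (b :+ c)))
        := (x :+ x) :+ ((a :+ a) :+ ((b :+ b) :+ (c :+ c)))) refl (π w (orbit w 3)) (mean L₁) (mean L₂) (mean L₃)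

-- Conditions under which the shorter diagonal is long enough.

module Thresholds (ℝ : CompleteOrderedField) where

  open Plane ℝ
  open Geometry ℝ
  open Rotation ℝ
  open import Relation.Binary.Reasoning.Setoid setoid

  fromℕ-nonNegative : ∀ n → 0# ≤ fromℕ n
  fromℕ-nonNegative zero    = ≤-refl
  fromℕ-nonNegative (suc n) = +-nonNegative 0≤1 (fromℕ-nonNegative n)

  fromℕ≉0 : ∀ n → ¬ fromℕ (suc n) ≈ 0#
  fromℕ≉0 n eq = 1≰0 (≤-respʳ-≈ eq (x≤x+y 1# (fromℕ-nonNegative n)))

  1≤nx⇒1/n≤x : ∀ n {x} → 1# ≤ fromℕ (suc n) * x → 1# / fromℕ (suc n) ≤ x
  1≤nx⇒1/n≤x n {x} le = ≤-respˡ-≈ (*-comm (N ⁻¹) 1#) (≤-respʳ-≈ eq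
    (*-monoˡ-≤ (⁻¹-nonNegative (fromℕ-nonNegative (suc n)) (fromℕ≉0 n)) le))
    where
    N : Carrier
    N = fromℕ (suc n)
    eq : N ⁻¹ * (N * x) ≈ x
    eq = begin
      N ⁻¹ * (N * x) ≈⟨ solve 3 (λ i n x → i :* (n :* x) := (n :* i) :* x) refl (N ⁻¹) N x ⟩
      N * N ⁻¹ * x   ≈⟨ *-congʳ (⁻¹-inverseʳ N (fromℕ≉0 n)) ⟩
      1# * x         ≈⟨ *-identityˡ x ⟩
      x              ∎

  square-mono : ∀ {x y} → 0# ≤ x → x ≤ y → x * x ≤ y * y
  square-mono {x} {y} 0≤x x≤y = ≤-trans (*-monoˡ-≤ 0≤x x≤y)
    (≤-respˡ-≈ (*-comm y x) (*-monoˡ-≤ (≤-trans 0≤x x≤y) x≤y))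

  -- With H² = 4σ² - τ² the claim reads 2√3 Hτ ≤ 3σ² + 2τ². Since 48 ≤ 49, 2√3 H ≤ 7σ, and 3σ² - 7στ
  -- + 2τ² = (σ - 2τ)(3σ - τ) is nonnegative.
  diagonal-long-small : ∀ σ τ H → 0# ≤ τ → τ + τ ≤ σ → H * H + τ * τ ≈ (σ + σ) * (σ + σ) →
    σ * σ + √3 * (H * τ + H * τ) ≤ H * H + (τ * τ + τ * τ + τ * τ)
  diagonal-long-small σ τ H 0≤τ 2τ≤σ H²+τ²≈4σ² = ≤-trans
    (+-monoʳ-≤ (σ * σ) (≤-respˡ-≈
      (solve 3 (λ r H t → t :* (r :* (H :+ H)) := r :* (H :* t :+ H :* t)) refl √3 H τ)
      (*-monoˡ-≤ 0≤τ 2√3H≤7σ)))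
    (≤-difference (*-nonNegative 0≤σ-2τ (+-nonNegative 0≤σ-2τ (+-nonNegative (+-nonNegative 0≤σ 0≤σ) 0≤τ)))
      (modulo H²+τ²≈4σ² (solve 3 (λ s t H →
        (s :- (t :+ t)) :* ((s :- (t :+ t)) :+ ((s :+ s) :+ t)) :- num 0
        := (H :* H :+ (t :* t :+ t :* t :+ t :* t) :- (s :* s :+ t :* (num 7 :* s)))
           :+ (H :* H :+ t :* t :- (s :+ s) :* (s :+ s)) :* (:- num 1)) refl σ τ H)))
    where
    0≤σ : 0# ≤ σ
    0≤σ = ≤-trans (+-nonNegative 0≤τ 0≤τ) 2τ≤σ
    0≤σ-2τ : 0# ≤ σ - (τ + τ)
    0≤σ-2τ = x≤y⇒0≤y-x 2τ≤σ
    7# : Carrier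
    7# = 1# + 1# + 1# + 1# + 1# + 1# + 1#
    0≤7σ : 0# ≤ 7# * σ
    0≤7σ = *-nonNegative (+-nonNegative (+-nonNegative (+-nonNegative (+-nonNegative
      (+-nonNegative (+-nonNegative 0≤1 0≤1) 0≤1) 0≤1) 0≤1) 0≤1) 0≤1) 0≤σ
    2√3H≤7σ : √3 * (H + H) ≤ 7# * σ
    2√3H≤7σ = x²≤y²⇒x≤y 0≤7σ (≤-difference
      (+-nonNegative (0≤x² σ) (+-nonNegative (0≤x² (τ + τ + τ))
        (+-nonNegative (0≤x² τ) (+-nonNegative (0≤x² τ) (0≤x² τ)))))
      (modulo √3² (modulo H²+τ²≈4σ² (solve 4 (λ r s t H →
        s :* s :+ ((t :+ t :+ t) :* (t :+ t :+ t) :+ (t :* t :+ (t :* t :+ t :* t))) :- num 0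
        := ((num 7 :* s) :* (num 7 :* s) :- (r :* (H :+ H)) :* (r :* (H :+ H))
            :+ (r :* r :- num 3) :* (num 4 :* H :* H))
           :+ (H :* H :+ t :* t :- (s :+ s) :* (s :+ s)) :* num 12) refl √3 σ τ H))))

  -- The claim again reads 2√3 Hτ ≤ 3σ² + 2τ². The squares of its sides differ by (4τ² - 3σ²)² -
  -- 12σ²τ², so 2√3 στ ≤ 4τ² - 3σ² suffices.
  diagonal-long-large : ∀ σ τ H √5 → 0# ≤ σ → 0# ≤ τ → √5 * √5 ≈ fromℕ 5 → √3 * σ + τ ≤ √5 * τ →
    H * H + τ * τ ≈ (σ + σ) * (σ + σ) →
    σ * σ + √3 * (H * τ + H * τ) ≤ H * H + (τ * τ + τ * τ + τ * τ)
  diagonal-long-large σ τ H √5 0≤σ 0≤τ √5² le H²+τ²≈4σ² = ≤-respʳ-≈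
    (sym (modulo H²+τ²≈4σ² (solve 3 (λ s t H → H :* H :+ (t :* t :+ t :* t :+ t :* t)
      := (s :* s :+ (num 3 :* s :* s :+ num 2 :* t :* t))
         :+ (H :* H :+ t :* t :- (s :+ s) :* (s :+ s)) :* num 1)
      refl σ τ H)))
    (+-monoʳ-≤ (σ * σ) (x²≤y²⇒x≤y (+-nonNegative (*-nonNegative (*-nonNegative 0≤3 0≤σ) 0≤σ)
        (*-nonNegative (*-nonNegative 0≤2 0≤τ) 0≤τ))
      (≤-difference (square-mono 0≤2√3στ 2√3στ≤4τ²-3σ²)
        (modulo √3² (modulo H²+τ²≈4σ² (solve 4 (λ r s t H →
          (num 4 :* t :* t :- num 3 :* s :* s) :* (num 4 :* t :* t :- num 3 :* s :* s)
            :- (r :* (s :* t :+ s :* t)) :* (r :* (s :* t :+ s :* t))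
          := (((num 3 :* s :* s :+ num 2 :* t :* t) :* (num 3 :* s :* s :+ num 2 :* t :* t)
               :- (r :* (H :* t :+ H :* t)) :* (r :* (H :* t :+ H :* t)))
              :+ (r :* r :- num 3) :* (num 4 :* t :* t :* (H :* H :- s :* s)))
             :+ (H :* H :+ t :* t :- (s :+ s) :* (s :+ s)) :* (num 12 :* t :* t)) refl √3 σ τ H))))))
    where
    0≤2 : 0# ≤ 1# + 1#
    0≤2 = +-nonNegative 0≤1 0≤1
    0≤3 : 0# ≤ 1# + 1# + 1#
    0≤3 = +-nonNegative 0≤2 0≤1
    0≤στ : 0# ≤ σ * τ
    0≤στ = *-nonNegative 0≤σ 0≤τ
    0≤2√3στ : 0# ≤ √3 * (σ * τ + σ * τ)
    0≤2√3στ = *-nonNegative √3-nonNegative (+-nonNegative 0≤στ 0≤στ)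
    -- This is the square of √3 σ + τ ≤ √5 τ rearranged, and the source of the threshold (√5 -
    -- 1)/√3.
    2√3στ≤4τ²-3σ² : √3 * (σ * τ + σ * τ) ≤ (1# + 1# + 1# + 1#) * τ * τ - (1# + 1# + 1#) * σ * σ
    2√3στ≤4τ²-3σ² = ≤-difference
      (square-mono (+-nonNegative (*-nonNegative √3-nonNegative 0≤σ) 0≤τ) le)
      (modulo √3² (modulo √5² (solve 4 (λ r f s t →
        (f :* t) :* (f :* t) :- (r :* s :+ t) :* (r :* s :+ t)
        := (((num 4 :* t :* t :- num 3 :* s :* s) :- r :* (s :* t :+ s :* t))
            :+ (r :* r :- num 3) :* (:- (s :* s)))
           :+ (f :* f :- nat 5) :* (t :* t)) refl √3 √5 σ τ)))

  √3≉0 : ¬ √3 ≈ 0#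
  √3≉0 eq = fromℕ≉0 2 (trans (sym √3²′) (trans (*-congʳ eq) (zeroˡ √3)))
    where
    √3²′ : √3 * √3 ≈ fromℕ 3
    √3²′ = trans √3² (solve 0 (num 3 := nat 3) refl)

-- The two ranges of d.

module LowerBound (ℝ : CompleteOrderedField) (c₀ : Plane.ProperColouring ℝ 4)
  (P : Plane.LeftInvariantProbability ℝ (Plane.S₄×E₂ ℝ)) where

  open Plane ℝ
  open RandomColouring ℝ c₀ P
  open Rotation ℝ
  open Thresholds ℝ
  open Bounds ℝ c₀ P
  open TwoDistances ℝ c₀ P
  open import Relation.Binary.Reasoning.Setoid setoid

  2x½≈x : ∀ x → ½ * x + ½ * x ≈ x
  2x½≈x x = modulo 2½≈1 (solve 2 (λ h x → h :* x :+ h :* x := x :+ (num 2 :* h :- num 1) :* x) refl ½ x)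

  ½+½≈1 : ½ + ½ ≈ 1#
  ½+½≈1 = modulo 2½≈1 (solve 1 (λ h → h :+ h := num 1 :+ (num 2 :* h :- num 1) :* num 1) refl ½)

  0≤½ : 0# ≤ ½
  0≤½ = ⁻¹-nonNegative (+-nonNegative 0≤1 0≤1) 1+1≉0

  unit-bounded : ∀ {ℓ²} → ℓ² ≈ 1# → Bounded 0# ℓ²
  unit-bounded ℓ²≈1 A B eq = ≤-reflexive (π-unit A B (antisym
    (x²≤y²⇒x≤y 0≤1 (≤-reflexive d²≈1)) (x²≤y²⇒x≤y (√-nonNegative _) (≤-reflexive (sym d²≈1)))))
    where
    d²≈1 : dist A B * dist A B ≈ 1# * 1#
    d²≈1 = trans (dist² A B) (trans eq (trans ℓ²≈1 (sym (*-identityˡ 1#))))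

  height : ∀ σ τ → 0# ≤ τ → τ ≤ σ + σ → ∃ λ H → 0# ≤ H × H * H + τ * τ ≈ (σ + σ) * (σ + σ)
  height σ τ 0≤τ τ≤2σ = √ x , √-nonNegative x ,
    trans (+-comm _ _) (trans (+-congˡ (√-square (x≤y⇒0≤y-x (square-mono 0≤τ τ≤2σ)))) (x+[y-x]≈y (τ * τ) _))
    where
    x = (σ + σ) * (σ + σ) - τ * τ

  π-lowerBound : ∀ d → 0# ≤ d → d ≤ (√ fromℕ 5 - 1#) / √ fromℕ 3 →
            ∀ A B → dist A B ≈ d → 1# / fromℕ 325 ≤ π A B
  π-lowerBound d 0≤d d≤ A B AB≈d = 1≤nx⇒1/n≤x 324 (byCases (total d ½))
    where
    p : Carrier
    p = π A B
    0≤p : 0# ≤ p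
    0≤p = LeftInvariantProbability.nonNegative P (sameColour c₀ A B)
    p-bounded : ∀ {ℓ} → ℓ ≈ d → Bounded p (ℓ * ℓ)
    p-bounded ℓ≈d A′ B′ eq = ≤-reflexive (π-congruent A′ B′ A B
      (trans eq (trans (*-cong ℓ≈d ℓ≈d) (trans (sym (*-cong AB≈d AB≈d)) (dist² A B)))))
    enlarge : ∀ m n → 1# ≤ fromℕ m * p → fromℕ m * p + fromℕ n * p ≈ fromℕ 325 * p → 1# ≤ fromℕ 325 * p
    enlarge m n le eq = ≤-trans le (≤-respʳ-≈ eq (x≤x+y _ (*-nonNegative (fromℕ-nonNegative n) 0≤p)))
    0≤½d : 0# ≤ ½ * d
    0≤½d = *-nonNegative 0≤½ 0≤d
    byCases : d ≤ ½ ⊎ ½ ≤ d → 1# ≤ fromℕ 325 * p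
    -- Here s = 1 and t = d, so α = 0, β = p and 1 ≤ 96p; 229 is 325 - 96.
    byCases (inj₁ d≤½) = enlarge 96 229
      (≤-respʳ-≈ (trans (+-congʳ (zeroʳ (fromℕ 211))) (+-identityˡ (fromℕ 96 * p)))
        (weighted-bound ½ (½ * d) H 0# p H² (*-nonNegative 0≤H 0≤½d)
          (diagonal-long-small ½ (½ * d) H 0≤½d d≤½′ H²)
          (unit-bounded (trans (*-cong ½+½≈1 ½+½≈1) (*-identityˡ 1#)))
          (p-bounded (2x½≈x d))))
      (solve 1 (λ p → nat 96 :* p :+ nat 229 :* p := nat 325 :* p) refl p)
      where
      d≤½′ : ½ * d + ½ * d ≤ ½
      d≤½′ = ≤-respˡ-≈ (sym (2x½≈x d)) d≤½
      ht = height ½ (½ * d) 0≤½d (≤-trans (x≤x+y _ 0≤½d) (≤-trans d≤½′ (x≤x+y _ 0≤½)))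
      H = proj₁ ht
      0≤H = proj₁ (proj₂ ht)
      H² = proj₂ (proj₂ ht)
    -- Here s = d and t = 1, so α = p, β = 0 and 1 ≤ 211p; 114 is 325 - 211.
    byCases (inj₂ ½≤d) = enlarge 211 114
      (≤-respʳ-≈ (trans (+-congˡ (zeroʳ (fromℕ 96))) (+-identityʳ (fromℕ 211 * p)))
        (weighted-bound (½ * d) ½ H p 0# H² (*-nonNegative 0≤H 0≤½)
          (diagonal-long-large (½ * d) ½ H (√ fromℕ 5) 0≤½d 0≤½ (√-square (fromℕ-nonNegative 5)) √3d+1≤√5 H²)
          (p-bounded (2x½≈x d))
          (unit-bounded (trans (*-cong ½+½≈1 ½+½≈1) (*-identityˡ 1#)))))
      (solve 1 (λ p → nat 211 :* p :+ nat 114 :* p := nat 325 :* p) refl p)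
      where
      -- A triangle with legs d and base 1 exists because ½ ≤ d.
      ht = height (½ * d) ½ 0≤½ (≤-respʳ-≈ (sym (2x½≈x d)) ½≤d)
      H = proj₁ ht
      0≤H = proj₁ (proj₂ ht)
      H² = proj₂ (proj₂ ht)
      √3d≤√5-1 : √3 * d ≤ √ fromℕ 5 - 1#
      √3d≤√5-1 = ≤-respʳ-≈ (begin
        √3 * ((√ fromℕ 5 - 1#) * √3 ⁻¹) ≈⟨ solve 3 (λ r x i → r :* (x :* i) := (r :* i) :* x)
                                             refl √3 (√ fromℕ 5 - 1#) (√3 ⁻¹) ⟩
        √3 * √3 ⁻¹ * (√ fromℕ 5 - 1#)   ≈⟨ *-congʳ (⁻¹-inverseʳ √3 √3≉0) ⟩
        1# * (√ fromℕ 5 - 1#)           ≈⟨ *-identityˡ _ ⟩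
        √ fromℕ 5 - 1#                  ∎)
        (*-monoˡ-≤ √3-nonNegative (≡.subst (λ r → d ≤ (√ fromℕ 5 - 1#) / r) (≡.sym √3≡) d≤))
      √3d+1≤√5 : √3 * (½ * d) + ½ ≤ √ fromℕ 5 * ½
      √3d+1≤√5 = ≤-difference (*-monoˡ-≤ 0≤½ √3d≤√5-1)
        (solve 4 (λ h r f d → h :* (f :- num 1) :- h :* (r :* d) := f :* h :- (r :* (h :* d) :+ h))
          refl ½ √3 (√ fromℕ 5) d)

mainTheorem9 : (ℝ : CompleteOrderedField) → let open Plane ℝ in
    (c₀ : ProperColouring 4) (P : LeftInvariantProbability S₄×E₂) →
    ∀ d → 0# ≤ d → d ≤ (√ fromℕ 5 - 1#) / √ fromℕ 3 →
    ∀ A B → dist A B ≈ d → 1# / fromℕ 325 ≤ monochromaticity c₀ P A B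
mainTheorem9 = LowerBound.π-lowerBound
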